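{- There exist a sequence of finite groups $(G_n)_{n\ge 1}$ with $|G_n|\to\infty$ and nontrivial irreducible representations $\rho_n$ of $G_n$ such that, for every constant $\delta > 0$, $\Omega(\log\log|G_n|)$ independent uniformly random elements are necessary to bound the expected norm of the average of $\rho_n$ by $1-\delta$. Precisely: for every $\delta > 0$ there exist $c > 0$ and $N$ such that for all $n \ge N$ and all integers $t\ge 1$ with $t \le c\log\log|G_n|$, $$ \mathbb{E}_{g_1,\ldots,g_t}\left[\,\left\|\frac{1}{t}\sum_{i=1}^t\rho_n(g_i)\right\|_{\mathrm{op}}\right] > 1-\delta, $$ where $g_1,\ldots,g_t$ are independent and uniformly random elements of $G_n$.
   Context: All representations are finite-dimensional, complex and unitary. $\|\cdot\|_{\mathrm{op}}$ is the operator norm induced by the Hermitian norm. -}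

module Defs where

open import Algebra.Bundles using (Group)
open import Algebra.Bundles.Raw using (RawMonoid)
import Algebra.Definitions.RawMonoid as RawMonoidDefinitions
open import Data.Fin.Base using (Fin; finToFun; toℕ)
open import Data.Fin.Properties using (nonZeroIndex) renaming (_≟_ to _≟ᶠ_)
open import Data.Integer.Base as ℤ using (+_)
import Data.Integer.Properties as ℤ
open import Data.Nat.Base as ℕ using (ℕ; zero; suc; z≤n; s≤s; _!; _^_)
import Data.Nat.Properties as ℕ
open import Data.Nat.Properties using (_!≢0)
open import Data.Product.Base using (∃; ∃-syntax; _×_; _,_; proj₁; proj₂)
open import Data.Rational.Base as ℚ using (ℚ; 0ℚ; 1ℚ; ½; ∣_∣)
import Data.Rational.Properties as ℚ
import Data.Rational.Solver
open import Data.Rational.Unnormalised.Base as ℚᵘ using ()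
import Data.Rational.Unnormalised.Properties as ℚᵘ
open import Data.Sum.Base using (_⊎_; inj₁; inj₂; [_,_]′)
open import Data.Vec.Functional using (Vector)
open import Function.Bundles using (Inverse)
open import Level using (0ℓ)
open import Relation.Nullary using (¬_; yes; no; contradiction)
open import Relation.Nullary.Decidable using (⌊_⌋)
open import Data.Bool.Base using (if_then_else_)
open import Relation.Binary.PropositionalEquality
  using (_≡_; refl; sym; trans; cong; cong₂; subst; subst₂)
import Relation.Binary.PropositionalEquality as ≡

open Data.Rational.Solver.+-*-Solver using (solve; _:=_; _:+_; _:*_; _:-_; :-_; con)

-- Cauchy sequences of rationals, taken up to _≃_.
record ℝ : Set where
  field
    seq    : ℕ → ℚ
    cauchy : ∀ ε → 0ℚ ℚ.< ε →
             ∃[ N ] (∀ m n → N ℕ.≤ m → N ℕ.≤ n → ∣ seq m ℚ.- seq n ∣ ℚ.< ε)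

open ℝ public

infix 4 _≃_ _≤ᴿ_ _<ᴿ_

_≃_ : ℝ → ℝ → Set
x ≃ y = ∀ ε → 0ℚ ℚ.< ε → ∃[ N ] (∀ n → N ℕ.≤ n → ∣ seq x n ℚ.- seq y n ∣ ℚ.< ε)

_≤ᴿ_ : ℝ → ℝ → Set
x ≤ᴿ y = ∀ ε → 0ℚ ℚ.< ε → ∃[ N ] (∀ n → N ℕ.≤ n → seq x n ℚ.< seq y n ℚ.+ ε)

_<ᴿ_ : ℝ → ℝ → Set
x <ᴿ y = ∃[ ε ] (0ℚ ℚ.< ε × ∃[ N ] (∀ n → N ℕ.≤ n → seq x n ℚ.+ ε ℚ.≤ seq y n))

<⇒≱ : ∀ {p q} → p ℚ.< q → ¬ (q ℚ.≤ p)
<⇒≱ p<q q≤p = ℚ.<-irrefl refl (ℚ.<-≤-trans p<q q≤p)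

half-pos : ∀ {ε} → 0ℚ ℚ.< ε → 0ℚ ℚ.< ½ ℚ.* ε
half-pos {ε} p =
  subst (ℚ._< ½ ℚ.* ε) (ℚ.*-zeroʳ ½) (ℚ.*-monoʳ-<-pos ½ p)

halves : ∀ ε → ½ ℚ.* ε ℚ.+ ½ ℚ.* ε ≡ ε
halves ε = trans (sym (ℚ.*-distribʳ-+ ε ½ ½)) (ℚ.*-identityˡ ε)

module _ (x : ℝ) where

  bound : ℚ
  bound = 1ℚ ℚ.+ ∣ seq x (proj₁ (cauchy x 1ℚ (ℚ.positive⁻¹ 1ℚ))) ∣

  bound-pos : ℚ.Positive bound
  bound-pos = ℚ.pos+nonNeg⇒pos 1ℚ ∣ b ∣ {{ℚ.∣-∣-nonNeg b}}
    where b = seq x (proj₁ (cauchy x 1ℚ (ℚ.positive⁻¹ 1ℚ)))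

  bound-spec : ∃[ N ] (∀ n → N ℕ.≤ n → ∣ seq x n ∣ ℚ.< bound)
  bound-spec with cauchy x 1ℚ (ℚ.positive⁻¹ 1ℚ)
  ... | N , h = N , λ n N≤n →
    let a = seq x n ; b = seq x N in
    ℚ.≤-<-trans
      (subst (λ z → ∣ z ∣ ℚ.≤ ∣ a ℚ.- b ∣ ℚ.+ ∣ b ∣)
        (solve 2 (λ a b → (a :- b) :+ b := a) refl a b)
        (ℚ.∣p+q∣≤∣p∣+∣q∣ (a ℚ.- b) b))
      (ℚ.+-monoˡ-< ∣ b ∣ (h n N N≤n ℕ.≤-refl))

⊔-≤ˡ : ∀ {k l n} → k ℕ.⊔ l ℕ.≤ n → k ℕ.≤ n
⊔-≤ˡ {k} {l} = ℕ.m⊔n≤o⇒m≤o k l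

⊔-≤ʳ : ∀ {k l n} → k ℕ.⊔ l ℕ.≤ n → l ℕ.≤ n
⊔-≤ʳ {k} {l} = ℕ.m⊔n≤o⇒n≤o k l

fromℚ : ℚ → ℝ
fromℚ q .seq _ = q
fromℚ q .cauchy ε 0<ε = 0 , λ _ _ _ _ →
  subst (ℚ._< ε) (sym (cong ∣_∣ (ℚ.+-inverseʳ q))) 0<ε

fromℕ : ℕ → ℝ
fromℕ n = fromℚ (+ n ℚ./ 1)

0ᴿ 1ᴿ : ℝ
0ᴿ = fromℚ 0ℚ
1ᴿ = fromℚ 1ℚ

infixl 6 _+ᴿ_ _-ᴿ_
infixl 7 _*ᴿ_
infix  8 -ᴿ_

_+ᴿ_ : ℝ → ℝ → ℝ
(x +ᴿ y) .seq n = seq x n ℚ.+ seq y n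
(x +ᴿ y) .cauchy ε 0<ε
  with cauchy x (½ ℚ.* ε) (half-pos 0<ε) | cauchy y (½ ℚ.* ε) (half-pos 0<ε)
... | M , hx | N , hy = M ℕ.⊔ N , λ m n p q →
  let a = seq x m ; b = seq y m ; c = seq x n ; d = seq y n in
  ℚ.≤-<-trans
    (subst (λ z → ∣ z ∣ ℚ.≤ ∣ a ℚ.- c ∣ ℚ.+ ∣ b ℚ.- d ∣)
      (solve 4 (λ a b c d → (a :- c) :+ (b :- d) := (a :+ b) :- (c :+ d)) refl a b c d)
      (ℚ.∣p+q∣≤∣p∣+∣q∣ (a ℚ.- c) (b ℚ.- d)))
    (subst (∣ a ℚ.- c ∣ ℚ.+ ∣ b ℚ.- d ∣ ℚ.<_) (halves ε)
      (ℚ.+-mono-< (hx m n (⊔-≤ˡ {M} p) (⊔-≤ˡ {M} q)) (hy m n (⊔-≤ʳ {M} p) (⊔-≤ʳ {M} q))))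

-ᴿ_ : ℝ → ℝ
(-ᴿ x) .seq n = ℚ.- seq x n
(-ᴿ x) .cauchy ε 0<ε with cauchy x ε 0<ε
... | N , h = N , λ m n p q →
  let a = seq x m ; b = seq x n in
  subst (ℚ._< ε)
    (trans (sym (ℚ.∣-p∣≡∣p∣ (a ℚ.- b))) (cong ∣_∣ (ℚ.neg-distrib-+ a (ℚ.- b))))
    (h m n p q)

_-ᴿ_ : ℝ → ℝ → ℝ
x -ᴿ y = x +ᴿ (-ᴿ y)

_*ᴿ_ : ℝ → ℝ → ℝ
(x *ᴿ y) .seq n = seq x n ℚ.* seq y n
(x *ᴿ y) .cauchy ε 0<ε = K , close
  where
  B C : ℚ
  B = bound x
  C = bound y
  instance
    B⁺ : ℚ.Positive B
    B⁺ = bound-pos x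
    C⁺ : ℚ.Positive C
    C⁺ = bound-pos y
    B≠0 : ℚ.NonZero B
    B≠0 = ℚ.pos⇒nonZero B
    C≠0 : ℚ.NonZero C
    C≠0 = ℚ.pos⇒nonZero C
    1/B⁺ : ℚ.Positive (ℚ.1/ B)
    1/B⁺ = ℚ.1/pos⇒pos B
    1/C⁺ : ℚ.Positive (ℚ.1/ C)
    1/C⁺ = ℚ.1/pos⇒pos C
  εB εC : ℚ
  εB = (ℚ.1/ B) ℚ.* (½ ℚ.* ε)
  εC = (ℚ.1/ C) ℚ.* (½ ℚ.* ε)

  scaled-pos : ∀ r .{{_ : ℚ.Positive r}} → 0ℚ ℚ.< r ℚ.* (½ ℚ.* ε)
  scaled-pos r = subst (ℚ._< r ℚ.* (½ ℚ.* ε)) (ℚ.*-zeroʳ r) (ℚ.*-monoʳ-<-pos r (half-pos 0<ε))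

  cancel : ∀ r .{{_ : ℚ.NonZero r}} → r ℚ.* ((ℚ.1/ r) ℚ.* (½ ℚ.* ε)) ≡ ½ ℚ.* ε
  cancel r = trans (sym (ℚ.*-assoc r (ℚ.1/ r) _))
    (trans (cong (ℚ._* (½ ℚ.* ε)) (ℚ.*-inverseʳ r)) (ℚ.*-identityˡ _))

  cx = cauchy x εC (scaled-pos (ℚ.1/ C))
  cy = cauchy y εB (scaled-pos (ℚ.1/ B))
  bx = bound-spec x
  by = bound-spec y

  K : ℕ
  K = (proj₁ cx ℕ.⊔ proj₁ cy) ℕ.⊔ (proj₁ bx ℕ.⊔ proj₁ by)

  product : ∀ {a b r s} .{{_ : ℚ.Positive r}} → ∣ a ∣ ℚ.< r → ∣ b ∣ ℚ.< s → ∣ a ℚ.* b ∣ ℚ.< r ℚ.* s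
  product {a} {b} {r} {s} a<r b<s =
    subst (ℚ._< r ℚ.* s) (sym (ℚ.∣p*q∣≡∣p∣*∣q∣ a b))
      (ℚ.≤-<-trans
        (ℚ.*-monoʳ-≤-nonNeg ∣ b ∣ {{ℚ.∣-∣-nonNeg b}} (ℚ.<⇒≤ a<r))
        (ℚ.*-monoʳ-<-pos r b<s))

  close : ∀ m n → K ℕ.≤ m → K ℕ.≤ n →
          ∣ seq x m ℚ.* seq y m ℚ.- seq x n ℚ.* seq y n ∣ ℚ.< ε
  close m n K≤m K≤n =
    ℚ.≤-<-trans
      (subst (λ z → ∣ z ∣ ℚ.≤ ∣ a ℚ.* (b ℚ.- d) ∣ ℚ.+ ∣ d ℚ.* (a ℚ.- c) ∣)
        (solve 4 (λ a b c d → a :* (b :- d) :+ d :* (a :- c) := a :* b :- c :* d) refl a b c d)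
        (ℚ.∣p+q∣≤∣p∣+∣q∣ (a ℚ.* (b ℚ.- d)) (d ℚ.* (a ℚ.- c))))
      (subst (∣ a ℚ.* (b ℚ.- d) ∣ ℚ.+ ∣ d ℚ.* (a ℚ.- c) ∣ ℚ.<_)
        (trans (cong₂ ℚ._+_ (cancel B) (cancel C)) (halves ε))
        (ℚ.+-mono-<
          (product {a} {b ℚ.- d} (proj₂ bx m (⊔-≤ˡ {proj₁ bx} (hi K≤m)))
            (proj₂ cy m n (⊔-≤ʳ {proj₁ cx} (lo K≤m)) (⊔-≤ʳ {proj₁ cx} (lo K≤n))))
          (product {d} {a ℚ.- c} (proj₂ by n (⊔-≤ʳ {proj₁ bx} (hi K≤n)))
            (proj₂ cx m n (⊔-≤ˡ {proj₁ cx} (lo K≤m)) (⊔-≤ˡ {proj₁ cx} (lo K≤n))))))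
    where
    a = seq x m
    b = seq y m
    c = seq x n
    d = seq y n
    lo : ∀ {k} → K ℕ.≤ k → proj₁ cx ℕ.⊔ proj₁ cy ℕ.≤ k
    lo = ⊔-≤ˡ {proj₁ cx ℕ.⊔ proj₁ cy}
    hi : ∀ {k} → K ℕ.≤ k → proj₁ bx ℕ.⊔ proj₁ by ℕ.≤ k
    hi = ⊔-≤ʳ {proj₁ cx ℕ.⊔ proj₁ cy}

sqrtSearch : ℚ → ℚ → ℕ → ℚ
sqrtSearch q h zero    = 0ℚ
sqrtSearch q h (suc k) with sqrtSearch q h k
... | s with (s ℚ.+ h) ℚ.* (s ℚ.+ h) ℚ.≤? q
... | yes _ = s ℚ.+ h
... | no  _ = s

fuel : ℚ → ℕ → ℕ
fuel q n = suc ℤ.∣ ℚ.numerator q ∣ ℕ.* suc n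

step : ℕ → ℚ
step n = + 1 ℚ./ suc n

opaque
  -- The largest multiple of 1/(n+1) whose square is at most q (0 if q < 0).
  sqrtApprox : ℚ → ℕ → ℚ
  sqrtApprox q n = sqrtSearch q (step n) (fuel q n)

sq : ℚ → ℚ
sq a = a ℚ.* a

step-pos : ∀ n → ℚ.Positive (step n)
step-pos n = ℚ.normalize-pos 1 (suc n)

fromℚᵘ-homo-+ : ∀ {p q r} → p ℚᵘ.+ q ℚᵘ.≃ r → ℚ.fromℚᵘ p ℚ.+ ℚ.fromℚᵘ q ≡ ℚ.fromℚᵘ r
fromℚᵘ-homo-+ {p} {q} {r} e = ℚ.toℚᵘ-injective
  (ℚᵘ.≃-trans (ℚ.toℚᵘ-homo-+ (ℚ.fromℚᵘ p) (ℚ.fromℚᵘ q))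
  (ℚᵘ.≃-trans (ℚᵘ.+-cong (ℚ.toℚᵘ-fromℚᵘ p) (ℚ.toℚᵘ-fromℚᵘ q))
  (ℚᵘ.≃-trans e (ℚᵘ.≃-sym (ℚ.toℚᵘ-fromℚᵘ r)))))

fromℚᵘ-homo-* : ∀ {p q r} → p ℚᵘ.* q ℚᵘ.≃ r → ℚ.fromℚᵘ p ℚ.* ℚ.fromℚᵘ q ≡ ℚ.fromℚᵘ r
fromℚᵘ-homo-* {p} {q} {r} e = ℚ.toℚᵘ-injective
  (ℚᵘ.≃-trans (ℚ.toℚᵘ-homo-* (ℚ.fromℚᵘ p) (ℚ.fromℚᵘ q))
  (ℚᵘ.≃-trans (ℚᵘ.*-cong (ℚ.toℚᵘ-fromℚᵘ p) (ℚ.toℚᵘ-fromℚᵘ q))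
  (ℚᵘ.≃-trans e (ℚᵘ.≃-sym (ℚ.toℚᵘ-fromℚᵘ r)))))

ℕ+1 : ∀ k → (+ k ℚ./ 1) ℚ.+ 1ℚ ≡ + suc k ℚ./ 1
ℕ+1 k = fromℚᵘ-homo-+ {ℚᵘ.mkℚᵘ (+ k) 0} {ℚᵘ.mkℚᵘ (+ 1) 0} {ℚᵘ.mkℚᵘ (+ suc k) 0}
  (ℚᵘ.*≡* (cong (ℤ._* + 1) (trans (cong (ℤ._+ + 1) (ℤ.*-identityʳ (+ k))) (cong +_ (ℕ.+-comm k 1)))))

ℕ*step : ∀ j n → (+ (j ℕ.* suc n) ℚ./ 1) ℚ.* step n ≡ + j ℚ./ 1
ℕ*step j n = fromℚᵘ-homo-* {ℚᵘ.mkℚᵘ (+ (j ℕ.* suc n)) 0} {ℚᵘ.mkℚᵘ (+ 1) n} {ℚᵘ.mkℚᵘ (+ j) 0}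
  (ℚᵘ.*≡* (trans (ℤ.*-identityʳ _) (trans (ℤ.*-identityʳ _)
    (trans (ℤ.pos-* j (suc n)) (cong (λ z → + j ℤ.* + z) (sym (ℕ.+-identityʳ (suc n))))))))

fromℚᵘ-mono : ∀ {p q} → p ℚᵘ.≤ q → ℚ.fromℚᵘ p ℚ.≤ ℚ.fromℚᵘ q
fromℚᵘ-mono {p} {q} p≤q = ℚ.toℚᵘ-cancel-≤
  (ℚᵘ.≤-respʳ-≃ (ℚᵘ.≃-sym (ℚ.toℚᵘ-fromℚᵘ q)) (ℚᵘ.≤-respˡ-≃ (ℚᵘ.≃-sym (ℚ.toℚᵘ-fromℚᵘ p)) p≤q))

i≤+∣i∣ : ∀ i → i ℤ.≤ + ℤ.∣ i ∣
i≤+∣i∣ (+ n)      = ℤ.≤-refl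
i≤+∣i∣ ℤ.-[1+ n ] = ℤ.-≤+

≤numerator : ∀ q → q ℚ.≤ + ℤ.∣ ℚ.numerator q ∣ ℚ./ 1
≤numerator q@(ℚ.mkℚ n d c) = subst (ℚ._≤ + ℤ.∣ n ∣ ℚ./ 1) (ℚ.fromℚᵘ-toℚᵘ q)
  (fromℚᵘ-mono {ℚᵘ.mkℚᵘ n d} {ℚᵘ.mkℚᵘ (+ ℤ.∣ n ∣) 0} (ℚᵘ.*≤*
    (subst₂ ℤ._≤_ (sym (ℤ.*-identityʳ n)) (ℤ.pos-* ℤ.∣ n ∣ (suc d))
      (ℤ.≤-trans (i≤+∣i∣ n) (ℤ.+≤+ (ℕ.m≤m*n ℤ.∣ n ∣ (suc d)))))))

step-small : ∀ ε → 0ℚ ℚ.< ε → ∃[ N ] (∀ n → N ℕ.≤ n → step n ℚ.≤ ε)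
step-small ε@(ℚ.mkℚ (+ suc a) d c) _ = d , λ n d≤n →
  subst (step n ℚ.≤_) (ℚ.fromℚᵘ-toℚᵘ ε)
    (fromℚᵘ-mono {ℚᵘ.mkℚᵘ (+ 1) n} {ℚᵘ.mkℚᵘ (+ suc a) d} (ℚᵘ.*≤*
      (subst₂ ℤ._≤_ (ℤ.pos-* 1 (suc d)) (ℤ.pos-* (suc a) (suc n))
        (ℤ.+≤+ (ℕ.*-mono-≤ {1} {suc a} (s≤s z≤n) (s≤s d≤n))))))
step-small (ℚ.mkℚ (+ zero) d c) 0<ε = contradiction (ℚ.positive 0<ε) λ ()
step-small (ℚ.mkℚ ℤ.-[1+ a ] d c) 0<ε = contradiction (ℚ.positive 0<ε) λ ()

sqrtSearch-nonNeg : ∀ q h .{{_ : ℚ.Positive h}} k → 0ℚ ℚ.≤ sqrtSearch q h k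
sqrtSearch-nonNeg q h zero = ℚ.≤-refl
sqrtSearch-nonNeg q h (suc k) with sqrtSearch q h k | sqrtSearch-nonNeg q h k
... | s | 0≤s with sq (s ℚ.+ h) ℚ.≤? q
... | yes _ = ℚ.+-mono-≤ 0≤s (ℚ.<⇒≤ (ℚ.positive⁻¹ h))
... | no  _ = 0≤s

sqrtSearch-lower : ∀ q h → 0ℚ ℚ.≤ q → ∀ k → sq (sqrtSearch q h k) ℚ.≤ q
sqrtSearch-lower q h 0≤q zero = 0≤q
sqrtSearch-lower q h 0≤q (suc k) with sqrtSearch q h k | sqrtSearch-lower q h 0≤q k
... | s | s²≤q with sq (s ℚ.+ h) ℚ.≤? q
... | yes p = p
... | no  _ = s²≤q

sqrtSearch-zero : ∀ q h .{{_ : ℚ.Positive h}} → q ℚ.< 0ℚ → ∀ k → sqrtSearch q h k ≡ 0ℚ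
sqrtSearch-zero q h q<0 zero = refl
sqrtSearch-zero q h q<0 (suc k) with sqrtSearch q h k | sqrtSearch-zero q h q<0 k
... | _ | refl with sq (0ℚ ℚ.+ h) ℚ.≤? q
... | no  _ = refl
... | yes p = contradiction
      (subst (0ℚ ℚ.≤_) (cong sq (sym (ℚ.+-identityˡ h)))
        (ℚ.<⇒≤ (ℚ.positive⁻¹ (sq h) {{ℚ.pos*pos⇒pos h h}})))
      (<⇒≱ (ℚ.≤-<-trans p q<0))

sqrtSearch-progress : ∀ q h k →
  q ℚ.< sq (sqrtSearch q h k ℚ.+ h) ⊎ sqrtSearch q h k ≡ (+ k ℚ./ 1) ℚ.* h
sqrtSearch-progress q h zero = inj₂ (sym (ℚ.*-zeroˡ h))
sqrtSearch-progress q h (suc k) with sqrtSearch q h k | sqrtSearch-progress q h k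
... | s | ih with sq (s ℚ.+ h) ℚ.≤? q
... | no ¬p = inj₁ (ℚ.≰⇒> ¬p)
... | yes p with ih
... | inj₁ lt = contradiction p (<⇒≱ lt)
... | inj₂ eq = inj₂ (trans (cong (ℚ._+ h) eq)
  (trans (cong ((+ k ℚ./ 1) ℚ.* h ℚ.+_) (sym (ℚ.*-identityˡ h)))
    (trans (sym (ℚ.*-distribʳ-+ h (+ k ℚ./ 1) 1ℚ)) (cong (ℚ._* h) (ℕ+1 k)))))

sq-mono : ∀ {a b} → 0ℚ ℚ.≤ a → a ℚ.≤ b → sq a ℚ.≤ sq b
sq-mono {a} {b} 0≤a a≤b = ℚ.≤-trans
  (ℚ.*-monoʳ-≤-nonNeg a {{ℚ.nonNegative 0≤a}} a≤b)
  (ℚ.*-monoˡ-≤-nonNeg b {{ℚ.nonNegative (ℚ.≤-trans 0≤a a≤b)}} a≤b)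

≤-addʳ : ∀ a {b} → 0ℚ ℚ.≤ b → a ℚ.≤ a ℚ.+ b
≤-addʳ a {b} 0≤b = subst (ℚ._≤ a ℚ.+ b) (ℚ.+-identityʳ a) (ℚ.+-monoʳ-≤ a 0≤b)

n≤sq : ∀ n → + suc n ℚ./ 1 ℚ.≤ sq (+ suc n ℚ./ 1)
n≤sq n = subst (ℚ._≤ sq K) (ℚ.*-identityʳ K)
  (ℚ.*-monoˡ-≤-nonNeg K {{ℚ.pos⇒nonNeg K {{ℚ.normalize-pos (suc n) 1}}}}
    (fromℚᵘ-mono {ℚᵘ.mkℚᵘ (+ 1) 0} {ℚᵘ.mkℚᵘ (+ suc n) 0}
      (ℚᵘ.*≤* (ℤ.+≤+ (s≤s z≤n)))))
  where K = + suc n ℚ./ 1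

sqrtSearch-upper : ∀ q h .{{_ : ℚ.Positive h}} k K → 0ℚ ℚ.≤ K → (+ k ℚ./ 1) ℚ.* h ≡ K →
                   q ℚ.< sq K → q ℚ.< sq (sqrtSearch q h k ℚ.+ h)
sqrtSearch-upper q h k K 0≤K kh≡K q<K² with sqrtSearch q h k | sqrtSearch-progress q h k
... | s | inj₁ lt = lt
... | s | inj₂ eq = ℚ.<-≤-trans q<K² (sq-mono 0≤K
  (subst (ℚ._≤ s ℚ.+ h) (trans eq kh≡K) (≤-addʳ s (ℚ.<⇒≤ (ℚ.positive⁻¹ h)))))

numerator-bound : ∀ q → q ℚ.< sq (+ suc ℤ.∣ ℚ.numerator q ∣ ℚ./ 1)
numerator-bound q = ℚ.<-≤-trans
  (ℚ.≤-<-trans (≤numerator q)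
    (subst₂ ℚ._<_ (ℚ.+-identityʳ _) (ℕ+1 k) (ℚ.+-monoʳ-< (+ k ℚ./ 1) (ℚ.positive⁻¹ 1ℚ))))
  (n≤sq k)
  where k = ℤ.∣ ℚ.numerator q ∣

sqrtSearch-lower⊎zero : ∀ q h .{{_ : ℚ.Positive h}} k →
                        sq (sqrtSearch q h k) ℚ.≤ q ⊎ sqrtSearch q h k ≡ 0ℚ
sqrtSearch-lower⊎zero q h k with 0ℚ ℚ.≤? q
... | yes 0≤q = inj₁ (sqrtSearch-lower q h 0≤q k)
... | no  0≰q = inj₂ (sqrtSearch-zero q h (ℚ.≰⇒> 0≰q) k)

opaque
  unfolding sqrtApprox

  sqrtApprox-upper : ∀ q n → q ℚ.< (sqrtApprox q n ℚ.+ step n) ℚ.* (sqrtApprox q n ℚ.+ step n)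
  sqrtApprox-upper q n =
    sqrtSearch-upper q (step n) {{step-pos n}} (fuel q n) (+ suc ℤ.∣ ℚ.numerator q ∣ ℚ./ 1)
      (ℚ.<⇒≤ (ℚ.positive⁻¹ _ {{ℚ.normalize-pos (suc ℤ.∣ ℚ.numerator q ∣) 1}}))
      (ℕ*step (suc ℤ.∣ ℚ.numerator q ∣) n) (numerator-bound q)

  sqrtApprox-nonNeg : ∀ q n → 0ℚ ℚ.≤ sqrtApprox q n
  sqrtApprox-nonNeg q n = sqrtSearch-nonNeg q (step n) {{step-pos n}} (fuel q n)

  sqrtApprox-lower : ∀ q n → sqrtApprox q n ℚ.* sqrtApprox q n ℚ.≤ q ⊎ sqrtApprox q n ≡ 0ℚ
  sqrtApprox-lower q n = sqrtSearch-lower⊎zero q (step n) {{step-pos n}} (fuel q n)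

sqrt-close : ∀ p q s t h e → 0ℚ ℚ.≤ t → sq s ℚ.≤ p ⊎ s ≡ 0ℚ → q ℚ.< sq (t ℚ.+ h) →
             0ℚ ℚ.≤ h → 0ℚ ℚ.< e → h ℚ.≤ e → p ℚ.- q ℚ.< sq e → s ℚ.- t ℚ.< e ℚ.+ e
sqrt-close p q s t h e 0≤t s-lower t-upper 0≤h 0<e h≤e p-q<e² = ℚ.≰⇒> λ far →
  <⇒≱ p<[t+2e]² (ℚ.≤-trans (sq-mono 0≤t+2e (t+2e≤s far)) (s²≤p far))
  where
  0≤e = ℚ.<⇒≤ 0<e
  instance
    e⁺ : ℚ.Positive e
    e⁺ = ℚ.positive 0<e
    e⁰ : ℚ.NonNegative e
    e⁰ = ℚ.nonNegative 0≤e
    t⁰ : ℚ.NonNegative t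
    t⁰ = ℚ.nonNegative 0≤t
  0≤t+2e : 0ℚ ℚ.≤ t ℚ.+ (e ℚ.+ e)
  0≤t+2e = ℚ.+-mono-≤ 0≤t (ℚ.+-mono-≤ 0≤e 0≤e)
  t+2e≤s : e ℚ.+ e ℚ.≤ s ℚ.- t → t ℚ.+ (e ℚ.+ e) ℚ.≤ s
  t+2e≤s far = subst (t ℚ.+ (e ℚ.+ e) ℚ.≤_)
    (solve 2 (λ s t → t :+ (s :- t) := s) refl s t)
    (ℚ.+-monoʳ-≤ t far)
  s²≤p : e ℚ.+ e ℚ.≤ s ℚ.- t → sq s ℚ.≤ p
  s²≤p far = [ (λ le → le) , (λ s≡0 → contradiction
    (ℚ.≤-trans (t+2e≤s far) (ℚ.≤-reflexive s≡0))
    (<⇒≱ (ℚ.+-mono-≤-< 0≤t (ℚ.+-mono-< 0<e 0<e)))) ]′ s-lower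
  rest : ℚ
  rest = (t ℚ.* e ℚ.+ t ℚ.* e) ℚ.+ (e ℚ.* e ℚ.+ e ℚ.* e)
  0≤te : 0ℚ ℚ.≤ t ℚ.* e
  0≤te = ℚ.nonNegative⁻¹ (t ℚ.* e) {{ℚ.nonNeg*nonNeg⇒nonNeg t e}}
  0≤ee : 0ℚ ℚ.≤ e ℚ.* e
  0≤ee = ℚ.nonNegative⁻¹ (e ℚ.* e) {{ℚ.nonNeg*nonNeg⇒nonNeg e e}}
  p<[t+2e]² : p ℚ.< sq (t ℚ.+ (e ℚ.+ e))
  p<[t+2e]² = ℚ.<-≤-trans
    (subst₂ ℚ._<_ (solve 2 (λ p q → (p :- q) :+ q := p) refl p q) refl
      (ℚ.+-mono-< p-q<e² t-upper))
    (ℚ.≤-trans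
      (ℚ.+-monoʳ-≤ (sq e)
        (sq-mono (ℚ.+-mono-≤ 0≤t 0≤h)
                 (ℚ.+-monoʳ-≤ t h≤e)))
      (subst (sq e ℚ.+ sq (t ℚ.+ e) ℚ.≤_)
        (solve 2 (λ t e → (e :* e :+ (t :+ e) :* (t :+ e)) :+ ((t :* e :+ t :* e) :+ (e :* e :+ e :* e))
                          := (t :+ (e :+ e)) :* (t :+ (e :+ e))) refl t e)
        (≤-addʳ _ {rest} (ℚ.+-mono-≤ (ℚ.+-mono-≤ 0≤te 0≤te) (ℚ.+-mono-≤ 0≤ee 0≤ee)))))

∣∣-< : ∀ {p ε} → p ℚ.< ε → ℚ.- p ℚ.< ε → ∣ p ∣ ℚ.< ε
∣∣-< {p} {ε} h₁ h₂ with ℚ.∣p∣≡p∨∣p∣≡-p p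
... | inj₁ e = subst (ℚ._< ε) (sym e) h₁
... | inj₂ e = subst (ℚ._< ε) (sym e) h₂

√ : ℝ → ℝ
√ x .seq n = sqrtApprox (seq x n) n
√ x .cauchy ε 0<ε = M ℕ.⊔ N , λ m n p q →
  ∣∣-< (near m n p q)
       (subst (ℚ._< ε) (solve 2 (λ a b → a :- b := :- (b :- a)) refl (s n) (s m)) (near n m q p))
  where
  s : ℕ → ℚ
  s n = sqrtApprox (seq x n) n
  e : ℚ
  e = ½ ℚ.* ε
  instance
    e⁺ : ℚ.Positive e
    e⁺ = ℚ.positive (half-pos 0<ε)
  small = step-small e (half-pos 0<ε)
  settled = cauchy x (sq e) (ℚ.positive⁻¹ (sq e) {{ℚ.pos*pos⇒pos e e}})
  M N : ℕ
  M = proj₁ small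
  N = proj₁ settled
  p≤∣p∣ : ∀ r → r ℚ.≤ ∣ r ∣
  p≤∣p∣ r with 0ℚ ℚ.≤? r
  ... | yes 0≤r = ℚ.≤-reflexive (sym (ℚ.0≤p⇒∣p∣≡p 0≤r))
  ... | no 0≰r = ℚ.≤-trans (ℚ.<⇒≤ (ℚ.≰⇒> 0≰r)) (ℚ.0≤∣p∣ r)
  near : ∀ m n → M ℕ.⊔ N ℕ.≤ m → M ℕ.⊔ N ℕ.≤ n → s m ℚ.- s n ℚ.< ε
  near m n p q = subst (s m ℚ.- s n ℚ.<_) (halves ε)
    (sqrt-close (seq x m) (seq x n) (s m) (s n) (step n) e
      (sqrtApprox-nonNeg (seq x n) n) (sqrtApprox-lower (seq x m) m) (sqrtApprox-upper (seq x n) n)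
      (ℚ.<⇒≤ (ℚ.positive⁻¹ (step n) {{step-pos n}})) (half-pos 0<ε)
      (proj₂ small n (⊔-≤ˡ {M} q))
      (ℚ.≤-<-trans (p≤∣p∣ _) (proj₂ settled m n (⊔-≤ʳ {M} p) (⊔-≤ʳ {M} q))))

+ᴿ-rawMonoid : RawMonoid 0ℓ 0ℓ
+ᴿ-rawMonoid = record { Carrier = ℝ ; _≈_ = _≃_ ; _∙_ = _+ᴿ_ ; ε = 0ᴿ }

open RawMonoidDefinitions +ᴿ-rawMonoid public using () renaming (sum to ∑ᴿ)

_^ᴿ_ : ℝ → ℕ → ℝ
x ^ᴿ zero  = 1ᴿ
x ^ᴿ suc k = x *ᴿ (x ^ᴿ k)

_ConvergesTo_ : (ℕ → ℝ) → ℝ → Set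
s ConvergesTo x = ∀ (ε : ℝ) → 0ᴿ <ᴿ ε →
  ∃[ K ] (∀ k → K ℕ.≤ k → (x -ᴿ ε <ᴿ s k) × (s k <ᴿ x +ᴿ ε))

expSum : ℝ → ℕ → ℝ
expSum y K = ∑ᴿ {K} λ k → (y ^ᴿ toℕ k) *ᴿ fromℚ ((+ 1 ℚ./ (toℕ k !)) {{toℕ k !≢0}})

-- ℓ is the natural logarithm of x, i.e. exp ℓ = x for the exponential series.
-- For x > 0 exactly one such ℓ exists up to ≃.
_IsLogOf_ : ℝ → ℝ → Set
ℓ IsLogOf x = expSum ℓ ConvergesTo x

record ℂ : Set where
  constructor _+i_
  field
    re im : ℝ

open ℂ public

infix 4 _≃ᶜ_
infixl 6 _+ᶜ_
infixl 7 _*ᶜ_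

_≃ᶜ_ : ℂ → ℂ → Set
z ≃ᶜ w = re z ≃ re w × im z ≃ im w

0ᶜ 1ᶜ : ℂ
0ᶜ = 0ᴿ +i 0ᴿ
1ᶜ = 1ᴿ +i 0ᴿ

_+ᶜ_ _*ᶜ_ : ℂ → ℂ → ℂ
z +ᶜ w = (re z +ᴿ re w) +i (im z +ᴿ im w)
z *ᶜ w = (re z *ᴿ re w -ᴿ im z *ᴿ im w) +i (re z *ᴿ im w +ᴿ im z *ᴿ re w)

conj : ℂ → ℂ
conj z = re z +i (-ᴿ im z)

∣_∣² : ℂ → ℝ
∣ z ∣² = re z *ᴿ re z +ᴿ im z *ᴿ im z

ℝ⇒ℂ : ℝ → ℂ
ℝ⇒ℂ x = x +i 0ᴿ

+ᶜ-rawMonoid : RawMonoid 0ℓ 0ℓ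
+ᶜ-rawMonoid = record { Carrier = ℂ ; _≈_ = _≃ᶜ_ ; _∙_ = _+ᶜ_ ; ε = 0ᶜ }

open RawMonoidDefinitions +ᶜ-rawMonoid public using () renaming (sum to ∑ᶜ)

ℂ^ : ℕ → Set
ℂ^ d = Vector ℂ d

Matrix : ℕ → Set
Matrix d = Fin d → Fin d → ℂ

infix 4 _≃ᵛ_ _≃ᴹ_
infixl 7 _*ᴹ_ _*ᵛ_

_≃ᵛ_ : ∀ {d} → ℂ^ d → ℂ^ d → Set
v ≃ᵛ w = ∀ i → v i ≃ᶜ w i

_≃ᴹ_ : ∀ {d} → Matrix d → Matrix d → Set
A ≃ᴹ B = ∀ i j → A i j ≃ᶜ B i j

_*ᴹ_ : ∀ {d} → Matrix d → Matrix d → Matrix d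
(A *ᴹ B) i j = ∑ᶜ λ k → A i k *ᶜ B k j

_*ᵛ_ : ∀ {d} → Matrix d → ℂ^ d → ℂ^ d
(A *ᵛ v) i = ∑ᶜ λ k → A i k *ᶜ v k

1ᴹ : ∀ {d} → Matrix d
1ᴹ i j = if ⌊ i ≟ᶠ j ⌋ then 1ᶜ else 0ᶜ

_† : ∀ {d} → Matrix d → Matrix d
(A †) i j = conj (A j i)

‖_‖ : ∀ {d} → ℂ^ d → ℝ
‖ v ‖ = √ (∑ᴿ λ i → ∣ v i ∣²)

-- r = ‖ A ‖op: the least r ≥ 0 with ‖ A v ‖ ≤ r ‖ v ‖ for all v.  Such an r is
-- unique up to ≃; as with the logarithm, "the" value is handled as a relation.
record IsOperatorNorm {d} (A : Matrix d) (r : ℝ) : Set where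
  field
    nonNeg : 0ᴿ ≤ᴿ r
    bounds : ∀ v → ‖ A *ᵛ v ‖ ≤ᴿ r *ᴿ ‖ v ‖
    least  : ∀ s → 0ᴿ ≤ᴿ s → (∀ v → ‖ A *ᵛ v ‖ ≤ᴿ s *ᴿ ‖ v ‖) → r ≤ᴿ s

record FiniteGroup : Set₁ where
  field
    group       : Group 0ℓ 0ℓ
    order       : ℕ
    enumeration : Inverse (≡.setoid (Fin order)) (Group.setoid group)

  open Group group public using (Carrier; _≈_; _∙_; ε; _⁻¹)

  element : Fin order → Carrier
  element = Inverse.to enumeration

  order-nonZero : ℕ.NonZero order
  order-nonZero = nonZeroIndex (Inverse.from enumeration ε)

record UnitaryRep (G : FiniteGroup) : Set where
  open FiniteGroup G
  field
    dim     : ℕ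
    ρ       : Carrier → Matrix dim
    ρ-cong  : ∀ {g h} → g ≈ h → ρ g ≃ᴹ ρ h
    ρ-∙     : ∀ g h → ρ (g ∙ h) ≃ᴹ ρ g *ᴹ ρ h
    ρ-ε     : ρ ε ≃ᴹ 1ᴹ
    unitary : ∀ g → (ρ g †) *ᴹ ρ g ≃ᴹ 1ᴹ

module _ {G : FiniteGroup} (R : UnitaryRep G) where
  open FiniteGroup G
  open UnitaryRep R

  record IsInvariantSubspace (W : ℂ^ dim → Set) : Set where
    field
      resp-≃    : ∀ {v w} → v ≃ᵛ w → W v → W w
      zero-mem  : W (λ _ → 0ᶜ)
      +-closed  : ∀ {v w} → W v → W w → W (λ i → v i +ᶜ w i)
      *-closed  : ∀ c {v} → W v → W (λ i → c *ᶜ v i)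
      invariant : ∀ g {v} → W v → W (ρ g *ᵛ v)

  -- The space is nonzero and an invariant subspace W ≠ 0 is the whole space.
  -- "W ≠ 0" is read positively: W has a member with a coordinate of positive modulus.
  record Irreducible : Set₁ where
    field
      dim-nonZero : ℕ.NonZero dim
      simple      : ∀ W → IsInvariantSubspace W →
                    ∃[ w ] (W w × ∃[ i ] (0ᴿ <ᴿ ∣ w i ∣²)) → ∀ v → W v

  Nontrivial : Set
  Nontrivial = ¬ (∀ g → ρ g ≃ᴹ 1ᴹ)

  average : ∀ t .{{_ : ℕ.NonZero t}} → (Fin t → Carrier) → Matrix dim
  average t g i j = ℝ⇒ℂ (fromℚ (+ 1 ℚ./ t)) *ᶜ ∑ᶜ λ k → ρ (g k) i j

mean : ∀ m .{{_ : ℕ.NonZero m}} → (Fin m → ℝ) → ℝ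
mean m f = fromℚ (+ 1 ℚ./ m) *ᴿ ∑ᴿ f

-- Expectation over t independent uniformly random elements of G, i.e. over a
-- uniformly random element of Gᵗ; finToFun enumerates Fin t → Fin |G|.
𝔼 : ∀ (G : FiniteGroup) t → ((Fin t → FiniteGroup.Carrier G) → ℝ) → ℝ
𝔼 G t f = mean (order ^ t) {{ℕ.m^n≢0 order t {{order-nonZero}}}} λ k → f λ i → element (finToFun k i)
  where open FiniteGroup G

{-# OPTIONS --safe #-}
module Submission where

-- G_n = A₄^m with m = 2ⁿ + 1, and ρ_n is the m-th tensor power of the action of A₄ on ℂ³ by even
-- signed permutation matrices.  View g₁, …, g_t as m columns in A₄^t.  If two or three columns
-- are equal, A₄ fixes a vector of the corresponding tensor factors (Σ eₓ⊗eₓ, respectively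
-- Σ eₓ⊗eₓ₊₁⊗eₓ₊₂), so as soon as no column is the only one of its kind, all gᵢ have a common fixed
-- vector and the average has norm at least 1.  There are only 12^t possible columns, and for
-- t ≤ n/8, hence for t ≤ (log log |G_n|)/16, it is very unlikely that any of them occurs exactly
-- once among the m.

open import Defs
open import Algebra.Bundles using (CommutativeMonoid; CommutativeRing; Group)
import Algebra.Properties.CommutativeMonoid.Sum as Sum
import Algebra.Properties.Semiring.Sum as SemiringSum
open import Data.Bool.Base using (Bool; true; false; not; _xor_; _∧_; if_then_else_)
import Data.Bool.Properties as Bool
open import Data.Fin.Base
  using (Fin; zero; suc; toℕ; fromℕ<; combine; quotient; remainder; remQuot; punchIn; punchOut; funToFin; finToFun)
open import Data.Fin.Patterns using (0F; 1F; 2F)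
open import Data.Fin.Properties
  using (_≟_; all?; any?; suc-injective; 0≢1+n; toℕ-fromℕ<; combine-injective; remQuot-combine; punchInᵢ≢i;
         punchOut-injective; punchIn-punchOut; finToFun-funToFin; funToFin-finToFin)
open import Data.Integer.Base as ℤ using (+_)
import Data.Integer.Properties as ℤ
open import Data.List.Base using (List; []; _∷_; tabulate)
open import Data.List.Relation.Unary.All using (All; []; _∷_)
import Data.List.Relation.Unary.All.Properties as All
open import Data.List.Relation.Unary.Any using (Any; here; there)
import Data.List.Relation.Unary.Any.Properties as Any
open import Data.Nat.Base as ℕ using (ℕ; zero; suc; z≤n; s≤s; _^_; _!; _≤_; NonZero)
import Data.Nat.Properties as ℕ
open import Data.Nat.Properties using (_!≢0)
open import Data.Product.Base using (Σ; ∃-syntax; _×_; _,_; proj₁; proj₂)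
open import Data.Rational.Base as ℚ using (ℚ; 0ℚ; 1ℚ; ½; ∣_∣)
import Data.Rational.Properties as ℚ
import Data.Rational.Solver
import Data.Rational.Unnormalised.Base as ℚᵘ
open import Data.Sum.Base using (_⊎_; inj₁; inj₂)
import Data.Vec.Functional as Vector
open import Function.Base using (_∘_)
open import Function.Bundles using (mk⇔)
import Relation.Binary.Reasoning.Setoid as SetoidReasoning
open import Relation.Nullary using (¬_; Dec; yes; no; contradiction)
open import Relation.Nullary.Decidable
  using (does; from-yes; dec-true; dec-false; does-⇔; ¬?; _→-dec_; _×-dec_)
open import Relation.Binary.PropositionalEquality
  using (_≡_; _≢_; refl; sym; trans; cong; cong₂; subst; subst₂; module ≡-Reasoning)

open Data.Rational.Solver.+-*-Solver using (solve; _:=_; _:+_; _:*_; _:-_; :-_; con)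
open Sum ℚ.+-0-commutativeMonoid using () renaming (sum to ∑; sum-cong-≗ to ∑-cong; ∑-comm to ∑-swap)
open SemiringSum (CommutativeRing.semiring ℚ.+-*-commutativeRing) using (*-distribˡ-sum; *-distribʳ-sum)

-- A₄ as V ⋊ C₃ with V = {0,1,2,3} the Klein four-group; it acts on the three
-- coordinate axes y ∈ C₃ by even signed permutations.
infixl 6 _+₃_ _⊕_

-- Why A₄: a character of order two has invariants in its even tensor powers only, and column values
-- that occur an odd number of times are common. The representation on ℂ³ is real with determinant
-- 1, so its second and third powers have invariants, and hence so do all powers k = 2a + 3b, that
-- is, all k ≥ 2. Only a column that occurs once is an obstruction. Moreover the matrices are signed
-- permutations, so that invariance becomes a count of minus signs modulo 2. The number of columns
-- is exponential in n to make log log |G_n| linear in n. For t ≤ n/8 there are 12^t ≤ 2^(4t) ≤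
-- 2^(n/2) possible columns, at most about the square root of m. A given position is then unique
-- with probability about exp(-m / 12^t), which beats the union bound over the m positions. The
-- fixed vector is not assembled from chosen pairs and triples: it is the sum of all basis vectors
-- on which every element of A₄ makes an even number of signs within each class of equal columns.

_+₃_ : Fin 3 → Fin 3 → Fin 3
0F +₃ y  = y
1F +₃ 0F = 1F
1F +₃ 1F = 2F
1F +₃ 2F = 0F
2F +₃ 0F = 2F
2F +₃ 1F = 0F
2F +₃ 2F = 1F

-₃_ : Fin 3 → Fin 3
-₃ 0F = 0F
-₃ 1F = 2F
-₃ 2F = 1F

-- The nonzero elements of V carry the labels 0, 1, 2 of C₃, whose sum is 0; so the sum of two
-- different ones, which is the third, has label -(u + v).
_⊕_ : Fin 4 → Fin 4 → Fin 4
zero  ⊕ v     = v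
suc u ⊕ zero  = suc u
suc u ⊕ suc v = if does (u ≟ v) then zero else suc (-₃ (u +₃ v))

rotate : Fin 3 → Fin 4 → Fin 4
rotate h zero    = zero
rotate h (suc u) = suc (u +₃ h)

-- The nonzero element u + 1 of V flips every axis except u.
flips : Fin 4 → Fin 3 → Bool
flips zero    y = false
flips (suc u) y = not (does (u ≟ y))

A₄ : Set
A₄ = Fin 12

flipOf : A₄ → Fin 4
flipOf = quotient {4} 3

turnOf : A₄ → Fin 3
turnOf = remainder {4} 3

flip : Fin 4 → A₄
flip v = combine {4} {3} v 0F

turn : Fin 3 → A₄
turn h = combine {4} {3} 0F h

infixl 7 _·_

opaque
  _·_ : A₄ → A₄ → A₄
  k · l = combine (flipOf k ⊕ rotate (turnOf k) (flipOf l)) (turnOf k +₃ turnOf l)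

  inv : A₄ → A₄
  inv k = combine (rotate (-₃ turnOf k) (flipOf k)) (-₃ turnOf k)

  -- k sends the basis vector e_y to ± e_(move k y), with sign − iff negates k y.
  move : A₄ → Fin 3 → Fin 3
  move k y = y +₃ turnOf k

  negates : A₄ → Fin 3 → Bool
  negates k y = flips (flipOf k) (move k y)

  ·-assoc : ∀ k l n → (k · l) · n ≡ k · (l · n)
  ·-assoc = from-yes (all? λ k → all? λ l → all? λ n → (k · l) · n ≟ k · (l · n))

  ·-identityʳ : ∀ k → k · zero ≡ k
  ·-identityʳ = from-yes (all? λ k → k · zero ≟ k)

  ·-identityˡ : ∀ k → zero · k ≡ k
  ·-identityˡ = from-yes (all? λ k → zero · k ≟ k)

  ·-inverseˡ : ∀ k → inv k · k ≡ zero
  ·-inverseˡ = from-yes (all? λ k → inv k · k ≟ zero)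

  ·-inverseʳ : ∀ k → k · inv k ≡ zero
  ·-inverseʳ = from-yes (all? λ k → k · inv k ≟ zero)

  move-· : ∀ k l y → move (k · l) y ≡ move k (move l y)
  move-· = from-yes (all? λ k → all? λ l → all? λ y → move (k · l) y ≟ move k (move l y))

  negates-· : ∀ k l y → negates (k · l) y ≡ negates l y xor negates k (move l y)
  negates-· = from-yes (all? λ k → all? λ l → all? λ y →
    negates (k · l) y Bool.≟ negates l y xor negates k (move l y))

  -- Determinant 1: an element of V flips none or two of the three axes, and `move k` only permutes
  -- them. This is the source of the invariant in the third tensor power.
  negates-even : ∀ k y → negates k (y +₃ 1F) xor negates k (y +₃ 2F) ≡ negates k y
  negates-even = from-yes (all? λ k → all? λ y →
    negates k (y +₃ 1F) xor negates k (y +₃ 2F) Bool.≟ negates k y)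

  move-identity : ∀ y → move zero y ≡ y
  move-identity = from-yes (all? λ y → move zero y ≟ y)

  move-inverse : ∀ k y → move (inv k) (move k y) ≡ y
  move-inverse = from-yes (all? λ k → all? λ y → move (inv k) (move k y) ≟ y)

  move-flip : ∀ v y → move (flip v) y ≡ y
  move-flip = from-yes (all? λ v → all? λ y → move (flip v) y ≟ y)

  move-turn : ∀ x y → move (turn (y +₃ (-₃ x))) x ≡ y
  move-turn = from-yes (all? λ x → all? λ y → move (turn (y +₃ (-₃ x))) x ≟ y)

  move-turn₁ : ∀ y → move (turn 1F) y ≢ y
  move-turn₁ = from-yes (all? λ y → ¬? (move (turn 1F) y ≟ y))

  negates-flip₀ : ∀ y → negates (flip zero) y ≡ false
  negates-flip₀ = from-yes (all? λ y → negates (flip zero) y Bool.≟ false)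

  -- V acts on the three axes by three different characters; irreducibility rests on this.
  flip-separates : ∀ x y → x ≢ y → negates (flip (suc x)) x ≢ negates (flip (suc x)) y
  flip-separates = from-yes (all? λ x → all? λ y →
    ¬? (x ≟ y) →-dec ¬? (negates (flip (suc x)) x Bool.≟ negates (flip (suc x)) y))

-- Sums with at most one nonzero term

module _ {c ℓ} (M : CommutativeMonoid c ℓ) where
  open CommutativeMonoid M using (Carrier; _≈_; setoid; ∙-congˡ; identityʳ)
    renaming (_∙_ to _+_; ε to 0#)
  open Sum M using (sum; sum-remove; sum-replicate-zero; sum-cong-≋)

  sum-zero : ∀ {n} (f : Fin n → Carrier) → (∀ j → f j ≈ 0#) → sum f ≈ 0#
  sum-zero {n} f f≈0 = CommutativeMonoid.trans M (sum-cong-≋ f≈0) (sum-replicate-zero n)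

  sum-single : ∀ {n} (f : Fin n → Carrier) i → (∀ j → j ≢ i → f j ≈ 0#) → sum f ≈ f i
  sum-single {suc n} f i f≈0 = begin
    sum f                            ≈⟨ sum-remove {i = i} f ⟩
    f i + sum (Vector.removeAt f i)  ≈⟨ ∙-congˡ (sum-zero _ (λ j → f≈0 (punchIn i j) (punchInᵢ≢i i j))) ⟩
    f i + 0#                         ≈⟨ identityʳ (f i) ⟩
    f i                              ∎
    where open SetoidReasoning setoid

xor-commutativeMonoid : CommutativeMonoid _ _
xor-commutativeMonoid = CommutativeRing.+-commutativeMonoid Bool.xor-∧-commutativeRing

open Sum xor-commutativeMonoid using () renaming (sum to parity; sum-cong-≗ to parity-cong;
  ∑-distrib-+ to parity-distrib-xor; ∑-comm to parity-comm)

-- Balanced assignments of axes to columns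

negations : ∀ {m} → (Fin m → Bool) → A₄ → (Fin m → Fin 3) → Bool
negations p k y = parity λ j → p j ∧ negates k (y j)

-- An assignment of axes to the columns in p is balanced if every element of A₄ negates an
-- even number of them.  Since the three axes together are balanced, the only obstruction
-- to a balanced assignment is that p has exactly one column.
module _ {m} (p : Fin m → Bool) where
  Balanceable : Set
  Balanceable = ∃[ y ] (∀ k → negations p k y ≡ false)

  -- The strengthening that the induction needs: the columns of `p` jointly behave like a single
  -- axis x, so that a further column on x would balance them.
  LeavesOver : Fin 3 → Set
  LeavesOver x = ∃[ y ] (∀ k → negations p k y ≡ negates k x)

  IsSingleton : Set
  IsSingleton = ∃[ j ] (p j ≡ true × (∀ i → p i ≡ true → i ≡ j))

private
  Trichotomy : ∀ {m} → (Fin m → Bool) → Set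
  Trichotomy p = (∀ j → p j ≡ false)
    ⊎ (IsSingleton p × (∀ x → LeavesOver p x))
    ⊎ (Balanceable p × (∀ x → LeavesOver p x))

  negations-empty : ∀ {m} (p : Fin m → Bool) → (∀ j → p j ≡ false) → ∀ k y → negations p k y ≡ false
  negations-empty p p≡∅ k y = sum-zero xor-commutativeMonoid _ λ j → cong (_∧ negates k (y j)) (p≡∅ j)

  -- A new column goes on axis 0 to balance old columns that leave over 0, or on axis x to leave
  -- over x when the old ones are balanced. This is the splitting of k ≥ 2 into twos and threes in
  -- inductive form.
  trichotomy : ∀ {m} (p : Fin m → Bool) → Trichotomy p
  trichotomy {zero} p = inj₁ λ ()
  trichotomy {suc m} p with p zero in p₀ | trichotomy (p ∘ suc)
  ... | false | inj₁ ∅ = inj₁ λ { zero → p₀ ; (suc j) → ∅ j }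
  ... | false | inj₂ (inj₁ ((j , pj , j!) , over)) =
    inj₂ (inj₁ ((suc j , pj ,
      λ { zero p₀≡true → contradiction (trans (sym p₀) p₀≡true) λ ()
        ; (suc i) pi → cong suc (j! i pi) })
      , λ x → let y , e = over x in
        (0F Vector.∷ y) , λ k → e k))
  ... | false | inj₂ (inj₂ ((y₀ , e₀) , over)) =
    inj₂ (inj₂ (((0F Vector.∷ y₀) , λ k → e₀ k)
      , λ x → let y , e = over x in
        (0F Vector.∷ y) , λ k → e k))
  ... | true | inj₁ ∅ = inj₂ (inj₁ ((zero , p₀ ,
        λ { zero _ → refl ; (suc i) pi → contradiction (trans (sym (∅ i)) pi) λ () })
      , λ x → (x Vector.∷ λ _ → 0F) , λ k → trans
          (cong (negates k x xor_) (negations-empty (p ∘ suc) ∅ k _))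
          (Bool.xor-identityʳ _)))
  ... | true | inj₂ (inj₁ (_ , over)) = inj₂ (inj₂ (
        (let y , e = over 0F in (0F Vector.∷ y) , λ k → trans
          (cong (negates k 0F xor_) (e k)) (Bool.xor-same (negates k 0F)))
      -- A singleton has no balanced assignment to fall back on; instead the axes x + 1 and x + 2
      -- together have the signs of x.
      , λ x → let y , e = over (x +₃ 2F) in ((x +₃ 1F) Vector.∷ y) , λ k → trans
          (cong (negates k (x +₃ 1F) xor_) (e k)) (negates-even k x)))
  ... | true | inj₂ (inj₂ ((y₀ , e₀) , over)) = inj₂ (inj₂ (
        (let y , e = over 0F in (0F Vector.∷ y) , λ k → trans
          (cong (negates k 0F xor_) (e k)) (Bool.xor-same (negates k 0F)))
      , λ x → (x Vector.∷ y₀) , λ k → trans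
          (cong (negates k x xor_) (e₀ k)) (Bool.xor-identityʳ _)))

balanceable : ∀ {m} (p : Fin m → Bool) → ¬ IsSingleton p → Balanceable p
balanceable p ¬single with trichotomy p
... | inj₁ ∅                     = (λ _ → 0F) , λ k → negations-empty p ∅ k _
... | inj₂ (inj₁ (single , _))   = contradiction single ¬single
... | inj₂ (inj₂ (balanced , _)) = balanced

-- Here `τ j` is the value of column j, later an element of A₄^t coded as a number. The equitable
-- assignments will be the support of the fixed vector.
Equitable : ∀ {m T} → (Fin m → Fin T) → (Fin m → Fin 3) → Set
Equitable τ y = ∀ c k → negations (λ j → does (τ j ≟ c)) k y ≡ false

does-≟-refl : ∀ {n} (i : Fin n) → does (i ≟ i) ≡ true
does-≟-refl i = dec-true (i ≟ i) refl

module _ {m T} (τ : Fin m → Fin T) where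
  equitable-exists : (∀ j → ∃[ i ] (i ≢ j × τ i ≡ τ j)) → ∃[ y ] Equitable τ y
  equitable-exists twin = (λ j → proj₁ (bal (τ j)) j) , λ c k →
    trans (parity-cong (λ j → agree c k j)) (proj₂ (bal c) k)
    where
    bal : ∀ c → Balanceable (λ j → does (τ j ≟ c))
    bal c = balanceable _ λ (j , τj≡c , j!) →
      let i , i≢j , τi≡τj = twin j in
      i≢j (j! i (trans (cong (λ t → does (t ≟ c)) τi≡τj) τj≡c))
    agree : ∀ c k j → does (τ j ≟ c) ∧ negates k (proj₁ (bal (τ j)) j) ≡
                      does (τ j ≟ c) ∧ negates k (proj₁ (bal c) j)
    agree c k j with τ j ≟ c
    ... | yes refl = refl
    ... | no  _    = refl

  -- The group element at column j depends only on the value of that column, so sorting the columns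
  -- by value leaves an even contribution from each class.
  equitable-even : ∀ {y} → Equitable τ y → ∀ (κ : Fin T → A₄) →
                   parity (λ j → negates (κ (τ j)) (y j)) ≡ false
  equitable-even {y} eq κ = begin
    parity (λ j → negates (κ (τ j)) (y j))
      ≡⟨ parity-cong (λ j → trans
           (cong (_∧ negates (κ (τ j)) (y j)) (sym (does-≟-refl (τ j))))
           (sym (sum-single xor-commutativeMonoid (λ c → does (τ j ≟ c) ∧ negates (κ c) (y j)) (τ j)
             λ c c≢ → cong (_∧ negates (κ c) (y j)) (dec-false (τ j ≟ c) (c≢ ∘ sym))))) ⟩
    parity (λ j → parity λ c → does (τ j ≟ c) ∧ negates (κ c) (y j))
      ≡⟨ parity-comm (λ j c → does (τ j ≟ c) ∧ negates (κ c) (y j)) ⟩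
    parity (λ c → parity λ j → does (τ j ≟ c) ∧ negates (κ c) (y j))
      ≡⟨ sum-zero xor-commutativeMonoid _ (λ c → eq c (κ c)) ⟩
    false ∎
    where open ≡-Reasoning

  -- By the cocycle law `negates-·`, the sign of k after a move by l is that of l plus that of k ·
  -- l. Balance is required under all of A₄, so both parts are even on each class.
  equitable-move : ∀ {y} → Equitable τ y → ∀ (κ : Fin T → A₄) →
                   Equitable τ (λ j → move (κ (τ j)) (y j))
  equitable-move {y} eq κ c k = begin
    parity (λ j → does (τ j ≟ c) ∧ negates k (move (κ (τ j)) (y j)))
      ≡⟨ parity-cong step₁ ⟩
    parity (λ j → does (τ j ≟ c) ∧ negates (κ c) (y j) xor does (τ j ≟ c) ∧ negates (k · κ c) (y j))
      ≡⟨ parity-distrib-xor (λ j → does (τ j ≟ c) ∧ negates (κ c) (y j)) _ ⟩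
    negations (λ j → does (τ j ≟ c)) (κ c) y xor negations (λ j → does (τ j ≟ c)) (k · κ c) y
      ≡⟨ cong₂ _xor_ (eq c (κ c)) (eq c (k · κ c)) ⟩
    false ∎
    where
    open ≡-Reasoning
    cancel : ∀ a b → b ≡ a xor (a xor b)
    cancel a b = trans (cong (_xor b) (sym (Bool.xor-same a))) (Bool.xor-assoc a a b)
    step₁ : ∀ j → does (τ j ≟ c) ∧ negates k (move (κ (τ j)) (y j)) ≡
            does (τ j ≟ c) ∧ negates (κ c) (y j) xor does (τ j ≟ c) ∧ negates (k · κ c) (y j)
    step₁ j with τ j ≟ c
    ... | yes refl = trans (cancel (negates (κ c) (y j)) _) (cong (negates (κ c) (y j) xor_) (sym (negates-· k (κ c) (y j))))
    ... | no  _    = refl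

-- Representations by signed permutation matrices

infix 4 _≐_ _≐ᶜ_

-- Termwise equality. The matrix entries are constant sequences, so most of the linear algebra holds
-- exactly at every index and reduces to rational sums.
_≐_ : ℝ → ℝ → Set
x ≐ y = ∀ n → seq x n ≡ seq y n

_≐ᶜ_ : ℂ → ℂ → Set
z ≐ᶜ w = re z ≐ re w × im z ≐ im w

eventually≡⇒≃ : ∀ {x y} N → (∀ n → N ℕ.≤ n → seq x n ≡ seq y n) → x ≃ y
eventually≡⇒≃ {x} {y} N x≡y ε 0<ε = N , λ n N≤n →
  subst (ℚ._< ε) (sym (cong ∣_∣ (trans (cong (ℚ._- seq y n) (x≡y n N≤n)) (ℚ.+-inverseʳ (seq y n))))) 0<ε

≐⇒≃ : ∀ {x y} → x ≐ y → x ≃ y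
≐⇒≃ {x} {y} x≐y = eventually≡⇒≃ {x} {y} 0 λ n _ → x≐y n

≐ᶜ⇒≃ᶜ : ∀ {z w} → z ≐ᶜ w → z ≃ᶜ w
≐ᶜ⇒≃ᶜ {z} {w} (p , q) = ≐⇒≃ {re z} {re w} p , ≐⇒≃ {im z} {im w} q

seq-∑ᴿ : ∀ {d} (f : Fin d → ℝ) n → seq (∑ᴿ f) n ≡ ∑ (λ i → seq (f i) n)
seq-∑ᴿ {zero}  f n = refl
seq-∑ᴿ {suc d} f n = cong (seq (f zero) n ℚ.+_) (seq-∑ᴿ (f ∘ suc) n)

seq-re-∑ᶜ : ∀ {d} (f : Fin d → ℂ) n → seq (re (∑ᶜ f)) n ≡ ∑ (λ i → seq (re (f i)) n)
seq-re-∑ᶜ {zero}  f n = refl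
seq-re-∑ᶜ {suc d} f n = cong (seq (re (f zero)) n ℚ.+_) (seq-re-∑ᶜ (f ∘ suc) n)

seq-im-∑ᶜ : ∀ {d} (f : Fin d → ℂ) n → seq (im (∑ᶜ f)) n ≡ ∑ (λ i → seq (im (f i)) n)
seq-im-∑ᶜ {zero}  f n = refl
seq-im-∑ᶜ {suc d} f n = cong (seq (im (f zero)) n ℚ.+_) (seq-im-∑ᶜ (f ∘ suc) n)

sign : Bool → ℚ
sign false = 1ℚ
sign true  = ℚ.- 1ℚ

sign-xor : ∀ a b → sign (a xor b) ≡ sign a ℚ.* sign b
sign-xor false false = refl
sign-xor false true  = refl
sign-xor true  false = refl
sign-xor true  true  = refl

sign-sq : ∀ a → sign a ℚ.* sign a ≡ 1ℚ
sign-sq false = refl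
sign-sq true  = refl

xor-idem⇒false : ∀ a → a ≡ a xor a → a ≡ false
xor-idem⇒false a e = trans e (Bool.xor-same a)

re-1ᴹ : ∀ {d} (i j : Fin d) n → seq (re (1ᴹ i j)) n ≡ (if does (i ≟ j) then 1ℚ else 0ℚ)
re-1ᴹ i j n with i ≟ j
... | yes _ = refl
... | no  _ = refl

im-1ᴹ : ∀ {d} (i j : Fin d) n → seq (im (1ᴹ i j)) n ≡ 0ℚ
im-1ᴹ i j n with i ≟ j
... | yes _ = refl
... | no  _ = refl

-- The data of a representation by signed permutation matrices, with g sending e_y to ± e_(act g y);
-- `neg-∙` is the cocycle condition on the signs.
record SignedAction (G : FiniteGroup) (d : ℕ) : Set where
  open FiniteGroup G
  field
    act      : Carrier → Fin d → Fin d
    neg      : Carrier → Fin d → Bool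
    act-cong : ∀ {g h} → g ≈ h → ∀ y → act g y ≡ act h y
    neg-cong : ∀ {g h} → g ≈ h → ∀ y → neg g y ≡ neg h y
    act-∙    : ∀ g h y → act (g ∙ h) y ≡ act g (act h y)
    act-ε    : ∀ y → act ε y ≡ y
    neg-∙    : ∀ g h y → neg (g ∙ h) y ≡ neg h y xor neg g (act h y)

  neg-ε : ∀ y → neg ε y ≡ false
  neg-ε y = xor-idem⇒false (neg ε y) (trans (neg-cong (Group.sym group (Group.identityˡ group ε)) y)
    (trans (neg-∙ ε ε y) (cong (λ z → neg ε y xor neg ε z) (act-ε y))))

  act-inverseˡ : ∀ g y → act (g ⁻¹) (act g y) ≡ y
  act-inverseˡ g y = trans (sym (act-∙ (g ⁻¹) g y)) (trans (act-cong (Group.inverseˡ group g) y) (act-ε y))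

  act-inverseʳ : ∀ g y → act g (act (g ⁻¹) y) ≡ y
  act-inverseʳ g y = trans (sym (act-∙ g (g ⁻¹) y)) (trans (act-cong (Group.inverseʳ group g) y) (act-ε y))

  act-injective : ∀ g {x y} → act g x ≡ act g y → x ≡ y
  act-injective g {x} {y} e = trans (sym (act-inverseˡ g x)) (trans (cong (act (g ⁻¹)) e) (act-inverseˡ g y))

  entry : Carrier → Fin d → Fin d → ℚ
  entry g i j = if does (act g j ≟ i) then sign (neg g j) else 0ℚ

  entry-hit : ∀ g j → entry g (act g j) j ≡ sign (neg g j)
  entry-hit g j = cong (if_then sign (neg g j) else 0ℚ) (dec-true (act g j ≟ act g j) refl)

  entry-miss : ∀ g {i j} → act g j ≢ i → entry g i j ≡ 0ℚ
  entry-miss g {i} {j} ≢i = cong (if_then sign (neg g j) else 0ℚ) (dec-false (act g j ≟ i) ≢i)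

  column-sum : ∀ g j (F : Fin d → ℚ) → ∑ (λ k → entry g k j ℚ.* F k) ≡ sign (neg g j) ℚ.* F (act g j)
  column-sum g j F = trans
    (sum-single ℚ.+-0-commutativeMonoid _ (act g j) λ k k≢ →
      trans (cong (ℚ._* F k) (entry-miss g (k≢ ∘ sym))) (ℚ.*-zeroˡ (F k)))
    (cong (ℚ._* F (act g j)) (entry-hit g j))

  -- Addressing the row as `act g j` makes j the place of its only nonzero entry and keeps inverses
  -- out of the formula.
  row-sum : ∀ g j (F : Fin d → ℚ) → ∑ (λ k → entry g (act g j) k ℚ.* F k) ≡ sign (neg g j) ℚ.* F j
  row-sum g j F = trans
    (sum-single ℚ.+-0-commutativeMonoid _ j λ k k≢j →
      trans (cong (ℚ._* F k) (entry-miss g (k≢j ∘ act-injective g))) (ℚ.*-zeroˡ (F k)))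
    (cong (ℚ._* F j) (entry-hit g j))

  entry-∙ : ∀ g h i j → entry (g ∙ h) i j ≡ sign (neg h j) ℚ.* entry g i (act h j)
  entry-∙ g h i j rewrite act-∙ g h j | neg-∙ g h j with act g (act h j) ≟ i
  ... | yes _ = sign-xor (neg h j) _
  ... | no  _ = sym (ℚ.*-zeroʳ (sign (neg h j)))

  entry-unitary : ∀ g i j → sign (neg g j) ℚ.* entry g (act g j) i ≡ (if does (i ≟ j) then 1ℚ else 0ℚ)
  entry-unitary g i j with i ≟ j
  ... | yes refl = trans (cong (sign (neg g i) ℚ.*_) (entry-hit g i)) (sign-sq (neg g i))
  ... | no  i≢j  = trans (cong (sign (neg g j) ℚ.*_) (entry-miss g (i≢j ∘ act-injective g)))
                         (ℚ.*-zeroʳ (sign (neg g j)))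

  entry-ε : ∀ i j → entry ε i j ≡ (if does (i ≟ j) then 1ℚ else 0ℚ)
  entry-ε i j rewrite act-ε j | neg-ε j with i ≟ j | j ≟ i
  ... | yes _   | yes _   = refl
  ... | no _    | no _    = refl
  ... | yes i≡j | no j≢i  = contradiction (sym i≡j) j≢i
  ... | no i≢j  | yes j≡i = contradiction (sym j≡i) i≢j

module _ {G : FiniteGroup} {d} (A : SignedAction G d) where
  open FiniteGroup G
  open SignedAction A

  matrix : Carrier → Matrix d
  matrix g i j = ℝ⇒ℂ (fromℚ (entry g i j))

  rep : UnitaryRep G
  rep = record
    { dim     = d
    ; ρ       = matrix
    ; ρ-cong  = λ {g} {h} g≈h i j → ≐ᶜ⇒≃ᶜ {matrix g i j} {matrix h i j}
        ((λ n → cong₂ (λ a b → if does (a ≟ i) then sign b else 0ℚ) (act-cong g≈h j) (neg-cong g≈h j)) , λ n → refl)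
    ; ρ-∙     = λ g h i j → ≐ᶜ⇒≃ᶜ {matrix (g ∙ h) i j} {(matrix g *ᴹ matrix h) i j}
        ( (λ n → trans (entry-∙ g h i j) (trans (sym (column-sum h j (entry g i)))
            (sym (trans (seq-re-∑ᶜ (λ k → matrix g i k *ᶜ matrix h k j) n)
              (∑-cong λ k → solve 2 (λ a b → a :* b :- con 0ℚ :* con 0ℚ := b :* a) refl (entry g i k) (entry h k j))))))
        , (λ n → sym (trans (seq-im-∑ᶜ (λ k → matrix g i k *ᶜ matrix h k j) n)
            (sum-zero ℚ.+-0-commutativeMonoid _ λ k →
              solve 2 (λ a b → a :* con 0ℚ :+ con 0ℚ :* b := con 0ℚ) refl (entry g i k) (entry h k j)))))
    ; ρ-ε     = λ i j → ≐ᶜ⇒≃ᶜ {matrix ε i j} {1ᴹ i j}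
        ((λ n → trans (entry-ε i j) (sym (re-1ᴹ i j n))) , λ n → sym (im-1ᴹ i j n))
    ; unitary = λ g i j → ≐ᶜ⇒≃ᶜ {((matrix g †) *ᴹ matrix g) i j} {1ᴹ i j}
        ( (λ n → trans (seq-re-∑ᶜ (λ k → (matrix g †) i k *ᶜ matrix g k j) n)
            (trans (∑-cong λ k → solve 2 (λ a b → a :* b :- (:- con 0ℚ) :* con 0ℚ := b :* a) refl (entry g k i) (entry g k j))
            (trans (column-sum g j (λ k → entry g k i)) (trans (entry-unitary g i j) (sym (re-1ᴹ i j n))))))
        , (λ n → trans (seq-im-∑ᶜ (λ k → (matrix g †) i k *ᶜ matrix g k j) n)
            (trans (sum-zero ℚ.+-0-commutativeMonoid _ λ k →
              solve 2 (λ a b → a :* con 0ℚ :+ (:- con 0ℚ) :* b := con 0ℚ) refl (entry g k i) (entry g k j))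
              (sym (im-1ᴹ i j n)))))
    }

record Represents {G : FiniteGroup} (R : UnitaryRep G) (A : SignedAction G (UnitaryRep.dim R)) : Set where
  open SignedAction A using (neg; entry; row-sum)
  field
    re-entry : ∀ g i j n → seq (re (UnitaryRep.ρ R g i j)) n ≡ entry g i j
    im-entry : ∀ g i j n → seq (im (UnitaryRep.ρ R g i j)) n ≡ 0ℚ

  re-apply : ∀ g (w : ℂ^ (UnitaryRep.dim R)) {i j} n → SignedAction.act A g j ≡ i →
             seq (re ((UnitaryRep.ρ R g *ᵛ w) i)) n ≡ sign (neg g j) ℚ.* seq (re (w j)) n
  re-apply g w {i} {j} n refl = trans (seq-re-∑ᶜ (λ k → UnitaryRep.ρ R g i k *ᶜ w k) n)
    (trans (∑-cong λ k → trans
        (cong₂ (λ a b → a ℚ.* seq (re (w k)) n ℚ.- b ℚ.* seq (im (w k)) n)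
          (re-entry g i k n) (im-entry g i k n))
        (solve 3 (λ a b c → a :* b :- con 0ℚ :* c := a :* b) refl
          (entry g i k) (seq (re (w k)) n) (seq (im (w k)) n)))
      (row-sum g j λ k → seq (re (w k)) n))

  im-apply : ∀ g (w : ℂ^ (UnitaryRep.dim R)) {i j} n → SignedAction.act A g j ≡ i →
             seq (im ((UnitaryRep.ρ R g *ᵛ w) i)) n ≡ sign (neg g j) ℚ.* seq (im (w j)) n
  im-apply g w {i} {j} n refl = trans (seq-im-∑ᶜ (λ k → UnitaryRep.ρ R g i k *ᶜ w k) n)
    (trans (∑-cong λ k → trans
        (cong₂ (λ a b → a ℚ.* seq (im (w k)) n ℚ.+ b ℚ.* seq (re (w k)) n)
          (re-entry g i k n) (im-entry g i k n))
        (solve 3 (λ a b c → a :* c :+ con 0ℚ :* b := a :* c) refl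
          (entry g i k) (seq (re (w k)) n) (seq (im (w k)) n)))
      (row-sum g j λ k → seq (im (w k)) n))

rep-represents : ∀ {G : FiniteGroup} {d} (A : SignedAction G d) → Represents (rep A) A
rep-represents A = record { re-entry = λ g i j n → refl ; im-entry = λ g i j n → refl }

-- Rational identities, reciprocals, and vectors supported on one axis

abstract
  re-scale : ∀ q z n → seq (re (ℝ⇒ℂ (fromℚ q) *ᶜ z)) n ≡ q ℚ.* seq (re z) n
  re-scale q z n = solve 3 (λ a b c → a :* b :- con 0ℚ :* c := a :* b) refl q (seq (re z) n) (seq (im z) n)

  im-scale : ∀ q z n → seq (im (ℝ⇒ℂ (fromℚ q) *ᶜ z)) n ≡ q ℚ.* seq (im z) n
  im-scale q z n = solve 3 (λ a b c → a :* c :+ con 0ℚ :* b := a :* c) refl q (seq (re z) n) (seq (im z) n)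

  average-same : ∀ a s t → ½ ℚ.* (a ℚ.+ s ℚ.* (t ℚ.* a)) ≡ ½ ℚ.* (1ℚ ℚ.+ s ℚ.* t) ℚ.* a
  average-same = solve 3 (λ a s t → con ½ :* (a :+ s :* (t :* a)) := con ½ :* (con 1ℚ :+ s :* t) :* a) refl

  -- Real part of (v · conj c · s r) · (s c) = v · s² · (|c|² r) for v = x + y i and c = a + b i.
  -- With s = ±1 and r = 1/|c|² the right side is v.
  ratio-re : ∀ x y a b s r →
    (x ℚ.* (a ℚ.* (s ℚ.* r)) ℚ.+ y ℚ.* (b ℚ.* (s ℚ.* r))) ℚ.* (s ℚ.* a)
    ℚ.- (y ℚ.* (a ℚ.* (s ℚ.* r)) ℚ.- x ℚ.* (b ℚ.* (s ℚ.* r))) ℚ.* (s ℚ.* b)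
    ≡ x ℚ.* ((s ℚ.* s) ℚ.* ((a ℚ.* a ℚ.+ b ℚ.* b) ℚ.* r))
  ratio-re = solve 6 (λ x y a b s r →
    (x :* (a :* (s :* r)) :+ y :* (b :* (s :* r))) :* (s :* a)
    :- (y :* (a :* (s :* r)) :- x :* (b :* (s :* r))) :* (s :* b)
    := x :* ((s :* s) :* ((a :* a :+ b :* b) :* r))) refl

  ratio-im : ∀ x y a b s r →
    (x ℚ.* (a ℚ.* (s ℚ.* r)) ℚ.+ y ℚ.* (b ℚ.* (s ℚ.* r))) ℚ.* (s ℚ.* b)
    ℚ.+ (y ℚ.* (a ℚ.* (s ℚ.* r)) ℚ.- x ℚ.* (b ℚ.* (s ℚ.* r))) ℚ.* (s ℚ.* a)
    ≡ y ℚ.* ((s ℚ.* s) ℚ.* ((a ℚ.* a ℚ.+ b ℚ.* b) ℚ.* r))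
  ratio-im = solve 6 (λ x y a b s r →
    (x :* (a :* (s :* r)) :+ y :* (b :* (s :* r))) :* (s :* b)
    :+ (y :* (a :* (s :* r)) :- x :* (b :* (s :* r))) :* (s :* a)
    := y :* ((s :* s) :* ((a :* a :+ b :* b) :* r))) refl

  zero-re : ∀ a b → a ℚ.* 0ℚ ℚ.- b ℚ.* 0ℚ ≡ 0ℚ
  zero-re = solve 2 (λ a b → a :* con 0ℚ :- b :* con 0ℚ := con 0ℚ) refl

  zero-im : ∀ a b → a ℚ.* 0ℚ ℚ.+ b ℚ.* 0ℚ ≡ 0ℚ
  zero-im = solve 2 (λ a b → a :* con 0ℚ :+ b :* con 0ℚ := con 0ℚ) refl

-- Because |1/a - 1/b| · ab = |b - a| and ab ≥ c².
inverse-close : ∀ {c a b u v ε} → 0ℚ ℚ.< c → c ℚ.≤ a → c ℚ.≤ b → a ℚ.* u ≡ 1ℚ → b ℚ.* v ≡ 1ℚ → 0ℚ ℚ.< ε →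
                ∣ b ℚ.- a ∣ ℚ.< ε ℚ.* (c ℚ.* c) → ∣ u ℚ.- v ∣ ℚ.< ε
inverse-close {c} {a} {b} {u} {v} {ε} 0<c c≤a c≤b au≡1 bv≡1 0<ε close =
  ℚ.*-cancelʳ-<-nonNeg (a ℚ.* b) {{ℚ.pos⇒nonNeg (a ℚ.* b) {{ab⁺}}}}
    (ℚ.≤-<-trans (ℚ.≤-reflexive scaled) (ℚ.<-≤-trans close
      (ℚ.*-monoˡ-≤-nonNeg ε {{ℚ.nonNegative (ℚ.<⇒≤ 0<ε)}}
        (ℚ.≤-trans (ℚ.*-monoʳ-≤-nonNeg c {{ℚ.nonNegative (ℚ.<⇒≤ 0<c)}} c≤a)
                   (ℚ.*-monoˡ-≤-nonNeg a {{ℚ.pos⇒nonNeg a {{a⁺}}}} c≤b)))))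
  where
  a⁺ : ℚ.Positive a
  a⁺ = ℚ.positive (ℚ.<-≤-trans 0<c c≤a)
  ab⁺ : ℚ.Positive (a ℚ.* b)
  ab⁺ = ℚ.pos*pos⇒pos a {{a⁺}} b {{ℚ.positive (ℚ.<-≤-trans 0<c c≤b)}}
  open ≡-Reasoning
  scaled : ∣ u ℚ.- v ∣ ℚ.* (a ℚ.* b) ≡ ∣ b ℚ.- a ∣
  scaled = begin
    ∣ u ℚ.- v ∣ ℚ.* (a ℚ.* b)
      ≡⟨ cong (∣ u ℚ.- v ∣ ℚ.*_) (sym (ℚ.0≤p⇒∣p∣≡p (ℚ.<⇒≤ (ℚ.positive⁻¹ (a ℚ.* b) {{ab⁺}})))) ⟩
    ∣ u ℚ.- v ∣ ℚ.* ∣ a ℚ.* b ∣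
      ≡⟨ sym (ℚ.∣p*q∣≡∣p∣*∣q∣ (u ℚ.- v) (a ℚ.* b)) ⟩
    ∣ (u ℚ.- v) ℚ.* (a ℚ.* b) ∣
      ≡⟨ cong ∣_∣ (solve 4 (λ u v a b → (u :- v) :* (a :* b) := (a :* u) :* b :- (b :* v) :* a) refl u v a b) ⟩
    ∣ (a ℚ.* u) ℚ.* b ℚ.- (b ℚ.* v) ℚ.* a ∣
      ≡⟨ cong ∣_∣ (cong₂ (λ p q → p ℚ.* b ℚ.- q ℚ.* a) au≡1 bv≡1) ⟩
    ∣ 1ℚ ℚ.* b ℚ.- 1ℚ ℚ.* a ∣
      ≡⟨ cong ∣_∣ (cong₂ ℚ._-_ (ℚ.*-identityˡ b) (ℚ.*-identityˡ a)) ⟩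
    ∣ b ℚ.- a ∣ ∎

abstract
  inverse : ∀ {a} → 0ℚ ℚ.< a → ∃[ u ] a ℚ.* u ≡ 1ℚ
  inverse {a} 0<a = (ℚ.1/ a) {{a≢0}} , ℚ.*-inverseʳ a {{a≢0}}
    where
    a≢0 : ℚ.NonZero a
    a≢0 = ℚ.pos⇒nonZero a {{ℚ.positive 0<a}}

  -- The product is exactly 1 from some index on, not just in the limit, so that `combination≃` can
  -- be proved termwise without estimates.
  reciprocal : ∀ x → 0ᴿ <ᴿ x → ∃[ y ] ∃[ M ] (∀ n → M ℕ.≤ n → seq x n ℚ.* seq y n ≡ 1ℚ)
  reciprocal x (c , 0<c , N , c≤) = y , N , λ n N≤n →
    trans (cong (ℚ._* proj₁ (1/capped n)) (sym (capped≡ n N≤n))) (proj₂ (1/capped n))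
    where
    -- The maximum with c makes every term invertible and changes only the terms before N.
    capped : ℕ → ℚ
    capped n = seq x n ℚ.⊔ c
    c≤capped : ∀ n → c ℚ.≤ capped n
    c≤capped n = ℚ.p≤q⊔p (seq x n) c
    capped≡ : ∀ n → N ℕ.≤ n → capped n ≡ seq x n
    capped≡ n N≤n = ℚ.p≥q⇒p⊔q≡p (subst (ℚ._≤ seq x n) (ℚ.+-identityˡ c) (c≤ n N≤n))
    1/capped : ∀ n → ∃[ u ] capped n ℚ.* u ≡ 1ℚ
    1/capped n = inverse (ℚ.<-≤-trans 0<c (c≤capped n))
    y : ℝ
    y .seq n = proj₁ (1/capped n)
    y .cauchy ε 0<ε =
      let M , close = cauchy x (ε ℚ.* (c ℚ.* c)) (ℚ.positive⁻¹ _
            {{ℚ.pos*pos⇒pos ε {{ℚ.positive 0<ε}} (c ℚ.* c) {{ℚ.pos*pos⇒pos c {{ℚ.positive 0<c}} c {{ℚ.positive 0<c}}}}}})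
      in N ℕ.⊔ M , λ m n p q →
        inverse-close 0<c (c≤capped m) (c≤capped n) (proj₂ (1/capped m)) (proj₂ (1/capped n)) 0<ε
          (subst₂ (λ u v → ∣ u ℚ.- v ∣ ℚ.< ε ℚ.* (c ℚ.* c))
            (sym (capped≡ n (⊔-≤ˡ {N} q))) (sym (capped≡ m (⊔-≤ˡ {N} p)))
            (close n m (⊔-≤ʳ {N} q) (⊔-≤ʳ {N} p)))

module _ {G : FiniteGroup} (R : UnitaryRep G) {W : ℂ^ (UnitaryRep.dim R) → Set} (inv : IsInvariantSubspace R W) where
  open IsInvariantSubspace inv
  ∑ᶜ-closed : ∀ n (f : Fin n → ℂ^ (UnitaryRep.dim R)) → (∀ j → W (f j)) → W (λ i → ∑ᶜ {n} λ j → f j i)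
  ∑ᶜ-closed zero  f f∈W = zero-mem
  ∑ᶜ-closed (suc n) f f∈W = resp-≃ {λ i → f zero i +ᶜ ∑ᶜ {n} λ j → f (suc j) i} {λ i → ∑ᶜ {suc n} λ j → f j i}
    (λ i → ≐ᶜ⇒≃ᶜ {f zero i +ᶜ ∑ᶜ {n} λ j → f (suc j) i} {∑ᶜ {suc n} λ j → f j i}
       ((λ k → trans (cong (seq (re (f zero i)) k ℚ.+_) (seq-re-∑ᶜ {n} (λ j → f (suc j) i) k)) (sym (seq-re-∑ᶜ {suc n} (λ j → f j i) k)))
       , (λ k → trans (cong (seq (im (f zero i)) k ℚ.+_) (seq-im-∑ᶜ {n} (λ j → f (suc j) i) k)) (sym (seq-im-∑ᶜ {suc n} (λ j → f j i) k)))))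
    (+-closed {f zero} {λ i → ∑ᶜ {n} λ j → f (suc j) i} (f∈W zero) (∑ᶜ-closed n (λ j → f (suc j)) (λ j → f∈W (suc j))))

sign-≢ : ∀ {a b} → a ≢ b → sign a ℚ.* sign b ≡ ℚ.- 1ℚ
sign-≢ {false} {false} a≢b = contradiction refl a≢b
sign-≢ {false} {true}  a≢b = refl
sign-≢ {true}  {false} a≢b = refl
sign-≢ {true}  {true}  a≢b = contradiction refl a≢b

re-*ᶜ : ∀ z w n {a b c d} → seq (re z) n ≡ a → seq (im z) n ≡ b → seq (re w) n ≡ c → seq (im w) n ≡ d →
        seq (re (z *ᶜ w)) n ≡ a ℚ.* c ℚ.- b ℚ.* d
re-*ᶜ z w n refl refl refl refl = refl

im-*ᶜ : ∀ z w n {a b c d} → seq (re z) n ≡ a → seq (im z) n ≡ b → seq (re w) n ≡ c → seq (im w) n ≡ d →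
        seq (im (z *ᶜ w)) n ≡ a ℚ.* d ℚ.+ b ℚ.* c
im-*ᶜ z w n refl refl refl refl = refl

-- For r = 1/|c|² this is v / (± c), with a real reciprocal in place of a complex division.
coefficient : ℂ → ℝ → Bool → ℂ → ℂ
coefficient c r b v = v *ᶜ (conj c *ᶜ ℝ⇒ℂ (fromℚ (sign b) *ᴿ r))

re-coefficient : ∀ c r b v n → seq (re (coefficient c r b v)) n ≡
  seq (re v) n ℚ.* (seq (re c) n ℚ.* (sign b ℚ.* seq r n)) ℚ.+ seq (im v) n ℚ.* (seq (im c) n ℚ.* (sign b ℚ.* seq r n))
re-coefficient c r b v n = solve 5 (λ x y a b k →
  x :* (a :* k :- (:- b) :* con 0ℚ) :- y :* (a :* con 0ℚ :+ (:- b) :* k) := x :* (a :* k) :+ y :* (b :* k)) refl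
  (seq (re v) n) (seq (im v) n) (seq (re c) n) (seq (im c) n) (sign b ℚ.* seq r n)

im-coefficient : ∀ c r b v n → seq (im (coefficient c r b v)) n ≡
  seq (im v) n ℚ.* (seq (re c) n ℚ.* (sign b ℚ.* seq r n)) ℚ.- seq (re v) n ℚ.* (seq (im c) n ℚ.* (sign b ℚ.* seq r n))
im-coefficient c r b v n = solve 5 (λ x y a b k →
  x :* (a :* con 0ℚ :+ (:- b) :* k) :+ y :* (a :* k :- (:- b) :* con 0ℚ) := y :* (a :* k) :- x :* (b :* k)) refl
  (seq (re v) n) (seq (im v) n) (seq (re c) n) (seq (im c) n) (sign b ℚ.* seq r n)

combination : ∀ {d} → ℂ → ℝ → (Fin d → Bool) → (Fin d → ℂ^ d) → ℂ^ d → ℂ^ d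
combination c r b moved v i = ∑ᶜ λ z → coefficient c r (b z) (v z) *ᶜ moved z i

module _ {d} (c : ℂ) (r : ℝ) N (inverts : ∀ n → N ℕ.≤ n → seq (∣ c ∣²) n ℚ.* seq r n ≡ 1ℚ)
         (moved : Fin d → ℂ^ d) (b : Fin d → Bool)
         (diagonal : ∀ z → moved z z ≐ᶜ ℝ⇒ℂ (fromℚ (sign (b z))) *ᶜ c)
         (off : ∀ z i → z ≢ i → moved z i ≐ᶜ 0ᶜ)
         (v : ℂ^ d)
         where
  private
    re-diagonal : ∀ i n → N ℕ.≤ n → seq (re (coefficient c r (b i) (v i) *ᶜ moved i i)) n ≡ seq (re (v i)) n
    re-diagonal i n N≤n = trans
      (re-*ᶜ (coefficient c r (b i) (v i)) (moved i i) n (re-coefficient c r (b i) (v i) n) (im-coefficient c r (b i) (v i) n)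
        (trans (proj₁ (diagonal i) n) (re-scale (sign (b i)) c n))
        (trans (proj₂ (diagonal i) n) (im-scale (sign (b i)) c n)))
      (trans (ratio-re (seq (re (v i)) n) (seq (im (v i)) n) (seq (re c) n) (seq (im c) n) (sign (b i)) (seq r n))
      (trans (cong₂ (λ p q → seq (re (v i)) n ℚ.* (p ℚ.* q)) (sign-sq (b i)) (inverts n N≤n))
        (ℚ.*-identityʳ (seq (re (v i)) n))))

    im-diagonal : ∀ i n → N ℕ.≤ n → seq (im (coefficient c r (b i) (v i) *ᶜ moved i i)) n ≡ seq (im (v i)) n
    im-diagonal i n N≤n = trans
      (im-*ᶜ (coefficient c r (b i) (v i)) (moved i i) n (re-coefficient c r (b i) (v i) n) (im-coefficient c r (b i) (v i) n)
        (trans (proj₁ (diagonal i) n) (re-scale (sign (b i)) c n))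
        (trans (proj₂ (diagonal i) n) (im-scale (sign (b i)) c n)))
      (trans (ratio-im (seq (re (v i)) n) (seq (im (v i)) n) (seq (re c) n) (seq (im c) n) (sign (b i)) (seq r n))
      (trans (cong₂ (λ p q → seq (im (v i)) n ℚ.* (p ℚ.* q)) (sign-sq (b i)) (inverts n N≤n))
        (ℚ.*-identityʳ (seq (im (v i)) n))))

    re-off : ∀ i n z → z ≢ i → seq (re (coefficient c r (b z) (v z) *ᶜ moved z i)) n ≡ 0ℚ
    re-off i n z z≢i = trans
      (re-*ᶜ (coefficient c r (b z) (v z)) (moved z i) n refl refl (proj₁ (off z i z≢i) n) (proj₂ (off z i z≢i) n))
      (zero-re (seq (re (coefficient c r (b z) (v z))) n) (seq (im (coefficient c r (b z) (v z))) n))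

    im-off : ∀ i n z → z ≢ i → seq (im (coefficient c r (b z) (v z) *ᶜ moved z i)) n ≡ 0ℚ
    im-off i n z z≢i = trans
      (im-*ᶜ (coefficient c r (b z) (v z)) (moved z i) n refl refl (proj₁ (off z i z≢i) n) (proj₂ (off z i z≢i) n))
      (zero-im (seq (re (coefficient c r (b z) (v z))) n) (seq (im (coefficient c r (b z) (v z))) n))

  -- The vector `moved z` is ± c at z and zero elsewhere, so the coefficients v z / (± c) reproduce
  -- v coordinate by coordinate.
  combination≃ : combination c r b moved v ≃ᵛ v
  combination≃ i =
      eventually≡⇒≃ {re (combination c r b moved v i)} {re (v i)} N (λ n N≤n →
        trans (seq-re-∑ᶜ (λ z → coefficient c r (b z) (v z) *ᶜ moved z i) n)
        (trans (sum-single ℚ.+-0-commutativeMonoid (λ z → seq (re (coefficient c r (b z) (v z) *ᶜ moved z i)) n) i (re-off i n))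
          (re-diagonal i n N≤n)))
    , eventually≡⇒≃ {im (combination c r b moved v i)} {im (v i)} N (λ n N≤n →
        trans (seq-im-∑ᶜ (λ z → coefficient c r (b z) (v z) *ᶜ moved z i) n)
        (trans (sum-single ℚ.+-0-commutativeMonoid (λ z → seq (im (coefficient c r (b z) (v z) *ᶜ moved z i)) n) i (im-off i n))
          (im-diagonal i n N≤n)))

-- An irreducibility criterion for signed permutation representations

module _ {G : FiniteGroup} (R : UnitaryRep G) (A : SignedAction G (UnitaryRep.dim R)) (R~A : Represents R A) where
  open FiniteGroup G
  open SignedAction A using (neg; act-inverseʳ)
  open Represents R~A using (re-apply; im-apply)

  module _ {W : ℂ^ (UnitaryRep.dim R) → Set} (inv : IsInvariantSubspace R W) where
    open IsInvariantSubspace inv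

    abstract
      -- ½ (1 ± g) keeps the coordinates on which the sign of g is the same as at x, and kills the others.
      isolate : ∀ x (gs : List Carrier) → All (λ g → ∀ y → SignedAction.act A g y ≡ y) gs → ∀ {w} → W w →
        ∃[ u ] (W u × (u x ≐ᶜ w x) × (∀ i → w i ≐ᶜ 0ᶜ ⊎ Any (λ g → neg g x ≢ neg g i) gs → u i ≐ᶜ 0ᶜ))
      isolate x [] [] {w} w∈W = w , w∈W , ((λ n → refl) , (λ n → refl)) , λ { i (inj₁ wi≐0) → wi≐0 }
      isolate x (g ∷ gs) (fix ∷ fixes) {w} w∈W =
        let u , u∈W , ux , u0 = isolate x gs fixes {w′} w′∈W
        in u , u∈W ,
           ((λ n → trans (proj₁ ux n) (trans (re-w′ x n) (keep (sign-sq (neg g x)) (seq (re (w x)) n))))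
           , (λ n → trans (proj₂ ux n) (trans (im-w′ x n) (keep (sign-sq (neg g x)) (seq (im (w x)) n))))) ,
           λ { i (inj₁ (r , s)) → u0 i (inj₁
                 ( (λ n → trans (re-w′ i n) (trans (cong (½ ℚ.* (1ℚ ℚ.+ S i) ℚ.*_) (r n)) (ℚ.*-zeroʳ (½ ℚ.* (1ℚ ℚ.+ S i)))))
                 , (λ n → trans (im-w′ i n) (trans (cong (½ ℚ.* (1ℚ ℚ.+ S i) ℚ.*_) (s n)) (ℚ.*-zeroʳ (½ ℚ.* (1ℚ ℚ.+ S i)))))))
             ; i (inj₂ (here ≢)) → u0 i (inj₁
                 ( (λ n → trans (re-w′ i n) (kill (sign-≢ ≢) (seq (re (w i)) n)))
                 , (λ n → trans (im-w′ i n) (kill (sign-≢ ≢) (seq (im (w i)) n)))))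
             ; i (inj₂ (there ≢s)) → u0 i (inj₂ ≢s) }
        where
        signed total w′ : ℂ^ (UnitaryRep.dim R)
        signed i = ℝ⇒ℂ (fromℚ (sign (neg g x))) *ᶜ (UnitaryRep.ρ R g *ᵛ w) i
        total i = w i +ᶜ signed i
        w′ i = ℝ⇒ℂ (fromℚ ½) *ᶜ total i
        signed∈W : W signed
        signed∈W = *-closed (ℝ⇒ℂ (fromℚ (sign (neg g x)))) {UnitaryRep.ρ R g *ᵛ w} (invariant g {w} w∈W)
        total∈W : W total
        total∈W = +-closed {w} {signed} w∈W signed∈W
        w′∈W : W w′
        w′∈W = *-closed (ℝ⇒ℂ (fromℚ ½)) {total} total∈W
        S : Fin (UnitaryRep.dim R) → ℚ
        S i = sign (neg g x) ℚ.* sign (neg g i)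
        keep : ∀ {s} → s ≡ 1ℚ → ∀ a → ½ ℚ.* (1ℚ ℚ.+ s) ℚ.* a ≡ a
        keep refl a = ℚ.*-identityˡ a
        kill : ∀ {s} → s ≡ ℚ.- 1ℚ → ∀ a → ½ ℚ.* (1ℚ ℚ.+ s) ℚ.* a ≡ 0ℚ
        kill refl a = ℚ.*-zeroˡ a
        re-g : ∀ i n → seq (re ((UnitaryRep.ρ R g *ᵛ w) i)) n ≡ sign (neg g i) ℚ.* seq (re (w i)) n
        re-g i n = re-apply g w n (fix i)
        im-g : ∀ i n → seq (im ((UnitaryRep.ρ R g *ᵛ w) i)) n ≡ sign (neg g i) ℚ.* seq (im (w i)) n
        im-g i n = im-apply g w n (fix i)
        re-w′ : ∀ i n → seq (re (w′ i)) n ≡ ½ ℚ.* (1ℚ ℚ.+ S i) ℚ.* seq (re (w i)) n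
        re-w′ i n = trans (re-scale ½ (total i) n)
          (trans (cong (λ c → ½ ℚ.* (seq (re (w i)) n ℚ.+ c))
              (trans (re-scale (sign (neg g x)) ((UnitaryRep.ρ R g *ᵛ w) i) n) (cong (sign (neg g x) ℚ.*_) (re-g i n))))
            (average-same (seq (re (w i)) n) (sign (neg g x)) (sign (neg g i))))
        im-w′ : ∀ i n → seq (im (w′ i)) n ≡ ½ ℚ.* (1ℚ ℚ.+ S i) ℚ.* seq (im (w i)) n
        im-w′ i n = trans (im-scale ½ (total i) n)
          (trans (cong (λ c → ½ ℚ.* (seq (im (w i)) n ℚ.+ c))
              (trans (im-scale (sign (neg g x)) ((UnitaryRep.ρ R g *ᵛ w) i) n) (cong (sign (neg g x) ℚ.*_) (im-g i n))))
            (average-same (seq (im (w i)) n) (sign (neg g x)) (sign (neg g i))))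

  -- The elements `gs` act diagonally, and their signs isolate a multiple c e_x inside W with |c|² >
  -- 0. Transitivity carries it to ± c e_z for every z, and these vectors span.
  irreducible : ℕ.NonZero (UnitaryRep.dim R) →
    (gs : List Carrier) → All (λ g → ∀ y → SignedAction.act A g y ≡ y) gs →
    (∀ x i → x ≢ i → Any (λ g → neg g x ≢ neg g i) gs) →
    (∀ x y → ∃[ g ] SignedAction.act A g x ≡ y) →
    Irreducible R
  irreducible d≢0 gs fixes separates transitive = record
    { dim-nonZero = d≢0
    ; simple      = λ W inv (w , w∈W , x , 0<wx) v →
        let u , u∈W , ux , u-off = isolate inv x gs fixes {w} w∈W
            r , N , inverts = reciprocal (∣ w x ∣²) 0<wx
        in spans W inv w x u u∈W ux (λ j x≢j → u-off j (inj₂ (separates x j x≢j))) r N inverts v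
    }
    where
    spans : ∀ W → IsInvariantSubspace R W → ∀ (w : ℂ^ (UnitaryRep.dim R)) x u → W u → u x ≐ᶜ w x →
            (∀ j → x ≢ j → u j ≐ᶜ 0ᶜ) →
            ∀ r N → (∀ n → N ℕ.≤ n → seq (∣ w x ∣²) n ℚ.* seq r n ≡ 1ℚ) → ∀ v → W v
    spans W inv w x u u∈W ux u-off r N inverts v =
      IsInvariantSubspace.resp-≃ inv {combination (w x) r b moved v} {v}
        (combination≃ (w x) r N inverts moved b moved-diagonal moved-off v)
        (∑ᶜ-closed R inv (UnitaryRep.dim R) (λ z i → coefficient (w x) r (b z) (v z) *ᶜ moved z i)
          λ z → IsInvariantSubspace.*-closed inv (coefficient (w x) r (b z) (v z)) {moved z} (IsInvariantSubspace.invariant inv (g z) {u} u∈W))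
      where
      g : Fin (UnitaryRep.dim R) → Carrier
      g z = proj₁ (transitive x z)
      gx : ∀ z → SignedAction.act A (g z) x ≡ z
      gx z = proj₂ (transitive x z)
      moved : Fin (UnitaryRep.dim R) → ℂ^ (UnitaryRep.dim R)
      moved z = UnitaryRep.ρ R (g z) *ᵛ u
      b : Fin (UnitaryRep.dim R) → Bool
      b z = neg (g z) x
      moved-diagonal : ∀ z → moved z z ≐ᶜ ℝ⇒ℂ (fromℚ (sign (b z))) *ᶜ w x
      moved-diagonal z =
          (λ n → trans (re-apply (g z) u n (gx z)) (trans (cong (sign (b z) ℚ.*_) (proj₁ ux n))
            (sym (re-scale (sign (b z)) (w x) n))))
        , (λ n → trans (im-apply (g z) u n (gx z)) (trans (cong (sign (b z) ℚ.*_) (proj₂ ux n))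
            (sym (im-scale (sign (b z)) (w x) n))))
      moved-off : ∀ z i → z ≢ i → moved z i ≐ᶜ 0ᶜ
      moved-off z i z≢i =
          (λ n → trans (re-apply (g z) u n (act-inverseʳ (g z) i))
            (trans (cong (sign (neg (g z) j) ℚ.*_) (proj₁ uj≐0 n)) (ℚ.*-zeroʳ (sign (neg (g z) j)))))
        , (λ n → trans (im-apply (g z) u n (act-inverseʳ (g z) i))
            (trans (cong (sign (neg (g z) j) ℚ.*_) (proj₂ uj≐0 n)) (ℚ.*-zeroʳ (sign (neg (g z) j)))))
        where
        j = SignedAction.act A (g z ⁻¹) i
        uj≐0 : u j ≐ᶜ 0ᶜ
        uj≐0 = u-off j λ x≡j → z≢i
          (trans (sym (gx z)) (trans (cong (SignedAction.act A (g z)) x≡j) (act-inverseʳ (g z) i)))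

-- Operator norm of an average with a fixed vector

re-*ᵛ : ∀ {d} (A : Matrix d) w i n → seq (re ((A *ᵛ w) i)) n ≡ ∑ (λ j → seq (re (A i j *ᶜ w j)) n)
re-*ᵛ A w i n = seq-re-∑ᶜ (λ j → A i j *ᶜ w j) n

im-*ᵛ : ∀ {d} (A : Matrix d) w i n → seq (im ((A *ᵛ w) i)) n ≡ ∑ (λ j → seq (im (A i j *ᶜ w j)) n)
im-*ᵛ A w i n = seq-im-∑ᶜ (λ j → A i j *ᶜ w j) n

-- Division by s: as s ≥ ½, the error ε/2 is at most s ε.
1<r+ε : ∀ {s r ε} → 0ℚ ℚ.< ε → ½ ℚ.≤ s → s ℚ.< r ℚ.* s ℚ.+ ½ ℚ.* ε → 1ℚ ℚ.< r ℚ.+ ε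
1<r+ε {s} {r} {ε} 0<ε ½≤s s< = ℚ.≰⇒> λ r+ε≤1 → <⇒≱ s< (begin
  r ℚ.* s ℚ.+ ½ ℚ.* ε  ≤⟨ ℚ.+-monoʳ-≤ (r ℚ.* s) (ℚ.*-monoʳ-≤-nonNeg ε {{ℚ.nonNegative (ℚ.<⇒≤ 0<ε)}} ½≤s) ⟩
  r ℚ.* s ℚ.+ s ℚ.* ε  ≡⟨ solve 3 (λ r s e → r :* s :+ s :* e := (r :+ e) :* s) refl r s ε ⟩
  (r ℚ.+ ε) ℚ.* s      ≤⟨ ℚ.*-monoʳ-≤-nonNeg s {{ℚ.nonNegative (ℚ.≤-trans (ℚ.<⇒≤ (ℚ.positive⁻¹ ½)) ½≤s)}} r+ε≤1 ⟩
  1ℚ ℚ.* s             ≡⟨ ℚ.*-identityˡ s ⟩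
  s                    ∎)
  where open ℚ.≤-Reasoning

-- Otherwise the approximation plus one step would be at most 1, yet its square exceeds q ≥ 1. Any
-- bound away from zero would do for the division in `1<r+ε`.
½≤sqrtApprox : ∀ q n → 1ℚ ℚ.≤ q → step n ℚ.≤ ½ → ½ ℚ.≤ sqrtApprox q n
½≤sqrtApprox q n 1≤q h≤½ = ℚ.≮⇒≥ λ s<½ → <⇒≱ (sqrtApprox-upper q n)
  (ℚ.≤-trans (sq-mono {sqrtApprox q n ℚ.+ step n} {1ℚ}
    (ℚ.+-mono-≤ (sqrtApprox-nonNeg q n) (ℚ.<⇒≤ (ℚ.positive⁻¹ (step n) {{step-pos n}})))
    (ℚ.+-mono-≤ {sqrtApprox q n} {½} {step n} {½} (ℚ.<⇒≤ s<½) h≤½)) 1≤q)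

module _ {d} (A : Matrix d) (w : ℂ^ d)
         (fixed : ∀ i → (A *ᵛ w) i ≐ᶜ w i)
         (1≤‖w‖² : ∀ n → 1ℚ ℚ.≤ ∑ (λ i → seq (∣ w i ∣²) n)) where
  private
    size image-size : ℕ → ℚ
    size n = seq (∑ᴿ λ i → ∣ w i ∣²) n
    image-size n = seq (∑ᴿ λ i → ∣ (A *ᵛ w) i ∣²) n

    image-size≡ : ∀ n → image-size n ≡ size n
    image-size≡ n = trans (seq-∑ᴿ (λ i → ∣ (A *ᵛ w) i ∣²) n) (trans
      (∑-cong λ i → cong₂ (λ p q → p ℚ.* p ℚ.+ q ℚ.* q) (proj₁ (fixed i) n) (proj₂ (fixed i) n))
      (sym (seq-∑ᴿ (λ i → ∣ w i ∣²) n)))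

    1≤size : ∀ n → 1ℚ ℚ.≤ size n
    1≤size n = subst (1ℚ ℚ.≤_) (sym (seq-∑ᴿ (λ i → ∣ w i ∣²) n)) (1≤‖w‖² n)

  fixed-vector⇒1≤norm : ∀ r → IsOperatorNorm A r → 1ᴿ ≤ᴿ r
  fixed-vector⇒1≤norm r isNorm ε 0<ε =
    let M , h≤½ = step-small ½ (ℚ.positive⁻¹ ½)
        N , close = IsOperatorNorm.bounds isNorm w (½ ℚ.* ε) (half-pos 0<ε)
    in M ℕ.⊔ N , λ n M⊔N≤n →
      1<r+ε {sqrtApprox (size n) n} {seq r n} 0<ε
        (½≤sqrtApprox (size n) n (1≤size n) (h≤½ n (⊔-≤ˡ {M} {N} M⊔N≤n)))
        -- The image of w has the same squared length as w at every index, so both sides contain the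
        -- same rational square root.
        (subst (λ q → sqrtApprox q n ℚ.< seq r n ℚ.* sqrtApprox (size n) n ℚ.+ ½ ℚ.* ε)
          (image-size≡ n) (close n (⊔-≤ʳ {M} {N} M⊔N≤n)))

∑-const : ∀ n c → ∑ {n} (λ _ → c) ≡ (+ n ℚ./ 1) ℚ.* c
∑-const zero    c = sym (ℚ.*-zeroˡ c)
∑-const (suc n) c = trans (cong (c ℚ.+_) (∑-const n c)) (trans
  (solve 2 (λ m c → c :+ m :* c := (m :+ con 1ℚ) :* c) refl (+ n ℚ./ 1) c) (cong (ℚ._* c) (ℕ+1 n)))

1/n*n : ∀ n .{{_ : ℕ.NonZero n}} → (+ 1 ℚ./ n) ℚ.* (+ n ℚ./ 1) ≡ 1ℚ
1/n*n (suc n) = trans (ℚ.*-comm (+ 1 ℚ./ suc n) (+ suc n ℚ./ 1))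
  (subst (λ m → (+ m ℚ./ 1) ℚ.* step n ≡ 1ℚ) (ℕ.*-identityˡ (suc n)) (ℕ*step 1 n))

mean-const : ∀ n .{{_ : ℕ.NonZero n}} c → (+ 1 ℚ./ n) ℚ.* ∑ {n} (λ _ → c) ≡ c
mean-const n c = trans (cong ((+ 1 ℚ./ n) ℚ.*_) (∑-const n c))
  (trans (sym (ℚ.*-assoc (+ 1 ℚ./ n) (+ n ℚ./ 1) c)) (trans (cong (ℚ._* c) (1/n*n n)) (ℚ.*-identityˡ c)))

0≤∑ : ∀ {m} (f : Fin m → ℚ) → (∀ i → 0ℚ ℚ.≤ f i) → 0ℚ ℚ.≤ ∑ f
0≤∑ {zero}  f 0≤f = ℚ.≤-refl
0≤∑ {suc m} f 0≤f = ℚ.+-mono-≤ (0≤f zero) (0≤∑ (f ∘ suc) (0≤f ∘ suc))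

term≤∑ : ∀ {m} (f : Fin m → ℚ) → (∀ i → 0ℚ ℚ.≤ f i) → ∀ i → f i ℚ.≤ ∑ f
term≤∑ {suc m} f 0≤f zero    = ≤-addʳ (f zero) (0≤∑ (f ∘ suc) (0≤f ∘ suc))
term≤∑ {suc m} f 0≤f (suc i) = ℚ.≤-trans (term≤∑ (f ∘ suc) (0≤f ∘ suc) i)
  (subst (ℚ._≤ ∑ f) (ℚ.+-identityˡ (∑ (f ∘ suc))) (ℚ.+-monoˡ-≤ (∑ (f ∘ suc)) (0≤f zero)))

indicator : Bool → ℚ
indicator true  = 1ℚ
indicator false = 0ℚ

module _ {G : FiniteGroup} (R : UnitaryRep G) (A : SignedAction G (UnitaryRep.dim R)) (R~A : Represents R A)
         (t : ℕ) .{{_ : ℕ.NonZero t}} (g : Fin t → FiniteGroup.Carrier G)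
         (S : Fin (UnitaryRep.dim R) → Bool)
         (S-invariant : ∀ k y → S (SignedAction.act A (g k) y) ≡ S y)
         (S-positive : ∀ k y → S y ≡ true → SignedAction.neg A (g k) y ≡ false)
         where
  open SignedAction A using (neg; entry; row-sum; act-inverseʳ)
  open Represents R~A using (re-entry; im-entry)

  indicatorVector : ℂ^ (UnitaryRep.dim R)
  indicatorVector i = ℝ⇒ℂ (fromℚ (indicator (S i)))

  private
    1/t : ℚ
    1/t = + 1 ℚ./ t

    signed-indicator : ∀ b c → (c ≡ true → b ≡ false) → sign b ℚ.* indicator c ≡ indicator c
    signed-indicator b false _ = ℚ.*-zeroʳ (sign b)
    signed-indicator b true  h = cong (λ b → sign b ℚ.* 1ℚ) (h refl)

    re-average : ∀ i j n → seq (re (average R t g i j)) n ≡ 1/t ℚ.* ∑ (λ k → entry (g k) i j)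
    re-average i j n = trans (re-scale 1/t (∑ᶜ λ k → UnitaryRep.ρ R (g k) i j) n)
      (cong (1/t ℚ.*_) (trans (seq-re-∑ᶜ (λ k → UnitaryRep.ρ R (g k) i j) n) (∑-cong λ k → re-entry (g k) i j n)))

    im-average : ∀ i j n → seq (im (average R t g i j)) n ≡ 0ℚ
    im-average i j n = trans (im-scale 1/t (∑ᶜ λ k → UnitaryRep.ρ R (g k) i j) n)
      (trans (cong (1/t ℚ.*_) (trans (seq-im-∑ᶜ (λ k → UnitaryRep.ρ R (g k) i j) n)
        (sum-zero ℚ.+-0-commutativeMonoid _ λ k → im-entry (g k) i j n))) (ℚ.*-zeroʳ 1/t))

    f : Fin (UnitaryRep.dim R) → ℚ
    f i = indicator (S i)

    re-term : ∀ i j n → seq (re (average R t g i j *ᶜ indicatorVector j)) n ≡ 1/t ℚ.* (∑ (λ k → entry (g k) i j) ℚ.* f j)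
    re-term i j n = trans
      (re-*ᶜ (average R t g i j) (indicatorVector j) n {1/t ℚ.* ∑ (λ k → entry (g k) i j)} {0ℚ} {f j} {0ℚ}
        (re-average i j n) (im-average i j n) refl refl)
      (solve 3 (λ q s x → q :* s :* x :- con 0ℚ :* con 0ℚ := q :* (s :* x)) refl 1/t (∑ (λ k → entry (g k) i j)) (f j))

    im-term : ∀ i j n → seq (im (average R t g i j *ᶜ indicatorVector j)) n ≡ 0ℚ
    im-term i j n = trans
      (im-*ᶜ (average R t g i j) (indicatorVector j) n {1/t ℚ.* ∑ (λ k → entry (g k) i j)} {0ℚ} {f j} {0ℚ}
        (re-average i j n) (im-average i j n) refl refl)
      (solve 2 (λ a x → a :* con 0ℚ :+ con 0ℚ :* x := con 0ℚ) refl (1/t ℚ.* ∑ (λ k → entry (g k) i j)) (f j))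

    row : ∀ k i → ∑ (λ j → entry (g k) i j ℚ.* f j) ≡ f i
    row k i = subst (λ i → ∑ (λ j → entry (g k) i j ℚ.* f j) ≡ f i) (act-inverseʳ (g k) i)
      (trans (row-sum (g k) j₀ f) (trans (signed-indicator (neg (g k) j₀) (S j₀) (S-positive k j₀))
        (cong indicator (sym (S-invariant k j₀)))))
      where j₀ = SignedAction.act A (FiniteGroup._⁻¹ G (g k)) i

    re-image : ∀ i n → ∑ (λ j → seq (re (average R t g i j *ᶜ indicatorVector j)) n) ≡ f i
    re-image i n = begin
      ∑ (λ j → seq (re (average R t g i j *ᶜ indicatorVector j)) n)
        ≡⟨ ∑-cong (λ j → re-term i j n) ⟩
      ∑ (λ j → 1/t ℚ.* (∑ (λ k → entry (g k) i j) ℚ.* f j))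
        ≡⟨ sym (*-distribˡ-sum 1/t (λ j → ∑ (λ k → entry (g k) i j) ℚ.* f j)) ⟩
      1/t ℚ.* ∑ (λ j → ∑ (λ k → entry (g k) i j) ℚ.* f j)
        ≡⟨ cong (1/t ℚ.*_) (∑-cong λ j → *-distribʳ-sum (f j) (λ k → entry (g k) i j)) ⟩
      1/t ℚ.* ∑ (λ j → ∑ λ k → entry (g k) i j ℚ.* f j)
        ≡⟨ cong (1/t ℚ.*_) (∑-swap λ j k → entry (g k) i j ℚ.* f j) ⟩
      1/t ℚ.* ∑ (λ k → ∑ λ j → entry (g k) i j ℚ.* f j)
        ≡⟨ cong (1/t ℚ.*_) (∑-cong λ k → row k i) ⟩
      1/t ℚ.* ∑ {t} (λ k → f i)
        ≡⟨ mean-const t (f i) ⟩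
      f i ∎
      where open ≡-Reasoning

    avg : Matrix (UnitaryRep.dim R)
    avg = average R t g

    re-image≡ : ∀ i n → seq (re (_*ᵛ_ {UnitaryRep.dim R} avg indicatorVector i)) n ≡ f i
    re-image≡ i n = trans {i = seq (re (_*ᵛ_ {UnitaryRep.dim R} avg indicatorVector i)) n}
      {j = ∑ {UnitaryRep.dim R} (λ j → seq (re (avg i j *ᶜ indicatorVector j)) n)} {k = f i}
      (re-*ᵛ {UnitaryRep.dim R} avg indicatorVector i n) (re-image i n)

    im-image≡ : ∀ i n → seq (im (_*ᵛ_ {UnitaryRep.dim R} avg indicatorVector i)) n ≡ 0ℚ
    im-image≡ i n = trans {i = seq (im (_*ᵛ_ {UnitaryRep.dim R} avg indicatorVector i)) n}
      {j = ∑ {UnitaryRep.dim R} (λ j → seq (im (avg i j *ᶜ indicatorVector j)) n)} {k = 0ℚ}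
      (im-*ᵛ {UnitaryRep.dim R} avg indicatorVector i n)
      (sum-zero ℚ.+-0-commutativeMonoid (λ j → seq (im (avg i j *ᶜ indicatorVector j)) n) λ j → im-term i j n)

  -- Each `g k` permutes S and makes no sign on it, hence fixes the indicator; so does the average,
  -- after exchanging the sums over k and over coordinates.
  average-fixes-indicator : ∀ i → (avg *ᵛ indicatorVector) i ≐ᶜ indicatorVector i
  average-fixes-indicator i = re-image≡ i , im-image≡ i

  indicator-size : ∀ y → S y ≡ true → ∀ n → 1ℚ ℚ.≤ ∑ (λ i → seq (∣ indicatorVector i ∣²) n)
  indicator-size y y∈S n = ℚ.≤-trans {j = ∑ λ i → square (S i)}
    (subst (λ b → square b ℚ.≤ ∑ λ i → square (S i)) y∈S (term≤∑ (λ i → square (S i)) (λ i → nonNeg (S i)) y))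
    (ℚ.≤-reflexive (∑-cong {x = λ i → square (S i)} {λ i → seq (∣ indicatorVector i ∣²) n} λ i → refl))
    where
    square : Bool → ℚ
    square b = indicator b ℚ.* indicator b ℚ.+ 0ℚ ℚ.* 0ℚ
    nonNeg : ∀ b → 0ℚ ℚ.≤ square b
    nonNeg false = ℚ.≤-refl
    nonNeg true  = ℚ.<⇒≤ (ℚ.positive⁻¹ 1ℚ)

  1≤norm-average : ∀ y → S y ≡ true → ∀ r → IsOperatorNorm (average R t g) r → 1ᴿ ≤ᴿ r
  1≤norm-average y y∈S = fixed-vector⇒1≤norm avg indicatorVector average-fixes-indicator (indicator-size y y∈S)

-- Counting tuples with a lonely value

count : ∀ {N} → (Fin N → Bool) → ℕ
count {zero}  p = 0
count {suc N} p = (if p zero then 1 else 0) ℕ.+ count (p ∘ suc)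

-- The pigeonhole principle for a partial map: whenever `p` holds at the head, its value is punched
-- out of the codomain.
count-injection : ∀ {N C} (p : Fin N → Bool) (f : ∀ k → p k ≡ true → Fin C) →
  (∀ {k l} pk pl → f k pk ≡ f l pl → k ≡ l) → count p ℕ.≤ C
count-injection {zero}  p f inj = z≤n
count-injection {suc N} p f inj with p zero in p₀
... | false = count-injection (p ∘ suc) (f ∘ suc) (λ pk pl → suc-injective ∘ inj pk pl)
... | true  = remove-head f inj
  where
  remove-head : ∀ {C} (f : ∀ k → p k ≡ true → Fin C) → (∀ {k l} pk pl → f k pk ≡ f l pl → k ≡ l) →
                suc (count (p ∘ suc)) ℕ.≤ C
  remove-head {zero} f inj with () ← f zero p₀
  remove-head {suc C} f inj = s≤s (count-injection (p ∘ suc) (λ k pk → punchOut (f₀≢ k pk))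
    λ {k} {l} pk pl → suc-injective ∘ inj pk pl ∘ punchOut-injective (f₀≢ k pk) (f₀≢ l pl))
    where
    f₀≢ : ∀ k pk → f zero p₀ ≢ f (suc k) pk
    f₀≢ k pk e = 0≢1+n (inj p₀ pk e)

Lonely : ∀ {m T} → (Fin m → Fin T) → Set
Lonely τ = ∃[ j ] (∀ i → i ≢ j → τ i ≢ τ j)

lonely? : ∀ {m T} (τ : Fin m → Fin T) → Dec (Lonely τ)
lonely? τ = any? λ j → all? λ i → ¬? (i ≟ j) →-dec ¬? (τ i ≟ τ j)

¬lonely⇒twins : ∀ {m T} (τ : Fin m → Fin T) → ¬ Lonely τ → ∀ j → ∃[ i ] (i ≢ j × τ i ≡ τ j)
¬lonely⇒twins τ ¬lonely j with any? (λ i → ¬? (i ≟ j) ×-dec (τ i ≟ τ j))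
... | yes twin = twin
... | no ¬twin = contradiction (j , λ i i≢j τi≡τj → ¬twin (i , i≢j , τi≡τj)) ¬lonely

lonely-witness : ∀ {m T} (τ : Fin m → Fin T) → does (lonely? τ) ≡ true → Lonely τ
lonely-witness τ e with lonely? τ
... | yes l = l

punchOut-cancel : ∀ {n} {a b x y : Fin (suc n)} (a≢x : a ≢ x) (b≢y : b ≢ y) → a ≡ b →
                  punchOut a≢x ≡ punchOut b≢y → x ≡ y
punchOut-cancel a≢x b≢y refl = punchOut-injective a≢x b≢y

funToFin-injective : ∀ {m n} {f g : Fin m → Fin n} → funToFin f ≡ funToFin g → ∀ i → f i ≡ g i
funToFin-injective {f = f} {g} e i =
  trans (sym (finToFun-funToFin f i)) (trans (cong (λ k → finToFun k i) e) (finToFun-funToFin g i))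

-- A tuple with a lonely position is encoded by that position, the value there,
-- and the other values, which avoid it.
module _ {N m u} (τ : Fin N → Fin (suc m) → Fin (suc u))
         (τ-injective : ∀ k l → (∀ j → τ k j ≡ τ l j) → k ≡ l) where
  private
    others : ∀ k → Lonely (τ k) → Fin m → Fin u
    others k (j , alone) i = punchOut (alone (punchIn j i) (punchInᵢ≢i j i) ∘ sym)

    code : ∀ k → Lonely (τ k) → Fin (suc m ℕ.* (suc u ℕ.* u ^ m))
    code k lonely = combine (proj₁ lonely) (combine (τ k (proj₁ lonely)) (funToFin (others k lonely)))

    code-injective : ∀ {k l} (a : Lonely (τ k)) (b : Lonely (τ l)) → code k a ≡ code l b → k ≡ l
    code-injective {k} {l} a@(j , aj) b@(j′ , bj) e with combine-injective j _ j′ _ e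
    ... | refl , e′ with combine-injective (τ k j) _ (τ l j) _ e′
    ... | τj≡ , e″ = τ-injective k l agree
      where
      agree-others : ∀ i → τ k (punchIn j i) ≡ τ l (punchIn j i)
      agree-others i = punchOut-cancel _ _ τj≡ (funToFin-injective e″ i)
      agree : ∀ i → τ k i ≡ τ l i
      agree i with j ≟ i
      ... | yes refl = τj≡
      ... | no  j≢i  = subst (λ i → τ k i ≡ τ l i) (punchIn-punchOut j≢i) (agree-others (punchOut j≢i))

  count-lonely : count (λ k → does (lonely? (τ k))) ℕ.≤ suc m ℕ.* (suc u ℕ.* u ^ m)
  count-lonely = count-injection _ (λ k e → code k (lonely-witness (τ k) e))
    (λ {k} {l} e e′ → code-injective (lonely-witness (τ k) e) (lonely-witness (τ l) e′))

-- Exponential estimates over the natural numbers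

bernoulli : ∀ u k → (u ℕ.+ k) ℕ.* u ^ k ℕ.≤ u ℕ.* suc u ^ k
bernoulli u zero    = ℕ.≤-reflexive (cong (ℕ._* 1) (ℕ.+-identityʳ u))
bernoulli u (suc k) = begin
  (u ℕ.+ suc k) ℕ.* (u ℕ.* u ^ k)             ≡⟨ sym (ℕ.*-assoc (u ℕ.+ suc k) u (u ^ k)) ⟩
  (u ℕ.+ suc k) ℕ.* u ℕ.* u ^ k               ≤⟨ ℕ.*-monoˡ-≤ (u ^ k) shift ⟩
  suc u ℕ.* (u ℕ.+ k) ℕ.* u ^ k               ≡⟨ ℕ.*-assoc (suc u) (u ℕ.+ k) (u ^ k) ⟩
  suc u ℕ.* ((u ℕ.+ k) ℕ.* u ^ k)             ≤⟨ ℕ.*-monoʳ-≤ (suc u) (bernoulli u k) ⟩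
  suc u ℕ.* (u ℕ.* suc u ^ k)                 ≡⟨ sym (ℕ.*-assoc (suc u) u (suc u ^ k)) ⟩
  suc u ℕ.* u ℕ.* suc u ^ k                   ≡⟨ cong (ℕ._* suc u ^ k) (ℕ.*-comm (suc u) u) ⟩
  u ℕ.* suc u ℕ.* suc u ^ k                   ≡⟨ ℕ.*-assoc u (suc u) (suc u ^ k) ⟩
  u ℕ.* (suc u ℕ.* suc u ^ k)                 ∎
  where
  open ℕ.≤-Reasoning
  shift : (u ℕ.+ suc k) ℕ.* u ℕ.≤ suc u ℕ.* (u ℕ.+ k)
  shift = begin
    (u ℕ.+ suc k) ℕ.* u              ≡⟨ cong (ℕ._* u) (ℕ.+-suc u k) ⟩
    u ℕ.+ (u ℕ.+ k) ℕ.* u            ≤⟨ ℕ.+-monoˡ-≤ ((u ℕ.+ k) ℕ.* u) (ℕ.m≤m+n u k) ⟩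
    (u ℕ.+ k) ℕ.+ (u ℕ.+ k) ℕ.* u    ≡⟨ cong (u ℕ.+ k ℕ.+_) (ℕ.*-comm (u ℕ.+ k) u) ⟩
    suc u ℕ.* (u ℕ.+ k)              ∎

-- The case k = u of `bernoulli`, which is (1 + 1/u)^k ≥ 1 + k/u cleared of denominators.
2*u^u≤[1+u]^u : ∀ u .{{_ : ℕ.NonZero u}} → 2 ℕ.* u ^ u ℕ.≤ suc u ^ u
2*u^u≤[1+u]^u u = ℕ.*-cancelˡ-≤ u (begin
  u ℕ.* (2 ℕ.* u ^ u)     ≡⟨ sym (ℕ.*-assoc u 2 (u ^ u)) ⟩
  u ℕ.* 2 ℕ.* u ^ u       ≡⟨ cong (ℕ._* u ^ u) (trans (ℕ.*-comm u 2) (cong (u ℕ.+_) (ℕ.+-identityʳ u))) ⟩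
  (u ℕ.+ u) ℕ.* u ^ u     ≤⟨ bernoulli u u ⟩
  u ℕ.* suc u ^ u         ∎)
  where open ℕ.≤-Reasoning

^-distribʳ-* : ∀ a b e → (a ℕ.* b) ^ e ≡ a ^ e ℕ.* b ^ e
^-distribʳ-* a b zero    = refl
^-distribʳ-* a b (suc e) = trans (cong (a ℕ.* b ℕ.*_) (^-distribʳ-* a b e))
  (ℕ.[m*n]*[o*p]≡[m*o]*[n*p] a b (a ^ e) (b ^ e))

-- A substitute for (1 - 1/T)^M ≤ exp(-M/T) with T = u + 1: each block of u factors gains a factor
-- 2, and M contains e blocks.
2^e*u^M≤[1+u]^M : ∀ u .{{_ : ℕ.NonZero u}} e M → u ℕ.* e ℕ.≤ M → 2 ^ e ℕ.* u ^ M ℕ.≤ suc u ^ M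
2^e*u^M≤[1+u]^M u e M ue≤M = begin
  2 ^ e ℕ.* u ^ M                                    ≡⟨ cong (λ k → 2 ^ e ℕ.* u ^ k) (sym M≡) ⟩
  2 ^ e ℕ.* u ^ (u ℕ.* e ℕ.+ r)                      ≡⟨ cong (2 ^ e ℕ.*_) (ℕ.^-distribˡ-+-* u (u ℕ.* e) r) ⟩
  2 ^ e ℕ.* (u ^ (u ℕ.* e) ℕ.* u ^ r)                ≡⟨ sym (ℕ.*-assoc (2 ^ e) _ _) ⟩
  2 ^ e ℕ.* u ^ (u ℕ.* e) ℕ.* u ^ r                  ≡⟨ cong (λ k → 2 ^ e ℕ.* k ℕ.* u ^ r) (sym (ℕ.^-*-assoc u u e)) ⟩
  2 ^ e ℕ.* (u ^ u) ^ e ℕ.* u ^ r                    ≡⟨ cong (ℕ._* u ^ r) (sym (^-distribʳ-* 2 (u ^ u) e)) ⟩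
  (2 ℕ.* u ^ u) ^ e ℕ.* u ^ r                        ≤⟨ ℕ.*-mono-≤ (ℕ.^-monoˡ-≤ e (2*u^u≤[1+u]^u u)) (ℕ.^-monoˡ-≤ r (ℕ.n≤1+n u)) ⟩
  (suc u ^ u) ^ e ℕ.* suc u ^ r                      ≡⟨ cong (ℕ._* suc u ^ r) (ℕ.^-*-assoc (suc u) u e) ⟩
  suc u ^ (u ℕ.* e) ℕ.* suc u ^ r                    ≡⟨ sym (ℕ.^-distribˡ-+-* (suc u) (u ℕ.* e) r) ⟩
  suc u ^ (u ℕ.* e ℕ.+ r)                            ≡⟨ cong (suc u ^_) M≡ ⟩
  suc u ^ M                                          ∎
  where
  open ℕ.≤-Reasoning
  r = M ℕ.∸ u ℕ.* e
  M≡ : u ℕ.* e ℕ.+ r ≡ M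
  M≡ = ℕ.m+[n∸m]≡n ue≤M

-- From s to s + 1 the quotient s^s / s! grows by the factor (1 + 1/s)^s ≥ 2. It makes a single term
-- of the exponential series large.
2^r*[1+r]!≤[1+r]^[1+r] : ∀ r → 2 ^ r ℕ.* suc r ℕ.! ℕ.≤ suc r ^ suc r
2^r*[1+r]!≤[1+r]^[1+r] zero    = ℕ.≤-refl
2^r*[1+r]!≤[1+r]^[1+r] (suc r) = begin
  2 ℕ.* 2 ^ r ℕ.* (s ℕ.* suc r ℕ.!)      ≡⟨ swap (2 ^ r) (suc r ℕ.!) ⟩
  s ℕ.* (2 ℕ.* (2 ^ r ℕ.* suc r ℕ.!))    ≤⟨ ℕ.*-monoʳ-≤ s (ℕ.*-monoʳ-≤ 2 (2^r*[1+r]!≤[1+r]^[1+r] r)) ⟩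
  s ℕ.* (2 ℕ.* suc r ^ suc r)            ≤⟨ ℕ.*-monoʳ-≤ s (2*u^u≤[1+u]^u (suc r)) ⟩
  s ℕ.* s ^ suc r                        ∎
  where
  open ℕ.≤-Reasoning
  s = suc (suc r)
  swap : ∀ a b → 2 ℕ.* a ℕ.* (s ℕ.* b) ≡ s ℕ.* (2 ℕ.* (a ℕ.* b))
  swap a b = trans (sym (ℕ.*-assoc (2 ℕ.* a) s b)) (trans (cong (ℕ._* b) (ℕ.*-comm (2 ℕ.* a) s))
    (trans (ℕ.*-assoc s (2 ℕ.* a) b) (cong (s ℕ.*_) (ℕ.*-assoc 2 a b))))

-- Logarithms

ι : ℕ → ℚ
ι n = + n ℚ./ 1

abstract
  ι-* : ∀ m n → ι m ℚ.* ι n ≡ ι (m ℕ.* n)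
  ι-* m n = fromℚᵘ-homo-* {ℚᵘ.mkℚᵘ (+ m) 0} {ℚᵘ.mkℚᵘ (+ n) 0} {ℚᵘ.mkℚᵘ (+ (m ℕ.* n)) 0}
    (ℚᵘ.*≡* (cong (ℤ._* + 1) (sym (ℤ.pos-* m n))))

  ι-mono-≤ : ∀ {m n} → m ℕ.≤ n → ι m ℚ.≤ ι n
  ι-mono-≤ {m} {n} m≤n = fromℚᵘ-mono {ℚᵘ.mkℚᵘ (+ m) 0} {ℚᵘ.mkℚᵘ (+ n) 0}
    (ℚᵘ.*≤* (ℤ.*-monoʳ-≤-nonNeg (+ 1) (ℤ.+≤+ m≤n)))

  ι-suc : ∀ n → ι n ℚ.+ 1ℚ ≡ ι (suc n)
  ι-suc = ℕ+1

  ι-mono-< : ∀ {m n} → m ℕ.< n → ι m ℚ.< ι n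
  ι-mono-< {m} m<n = ℚ.<-≤-trans
    (subst₂ ℚ._<_ (ℚ.+-identityʳ (ι m)) (ι-suc m) (ℚ.+-monoʳ-< (ι m) (ℚ.positive⁻¹ 1ℚ))) (ι-mono-≤ m<n)

  0≤ι : ∀ n → 0ℚ ℚ.≤ ι n
  0≤ι n = ι-mono-≤ {0} {n} z≤n

ι-cancel-< : ∀ {m n} → ι m ℚ.< ι n → m ℕ.< n
ι-cancel-< {m} {n} m<n = ℕ.≰⇒> λ n≤m → <⇒≱ m<n (ι-mono-≤ n≤m)

*-mono-≤ : ∀ {a b c d} → 0ℚ ℚ.≤ a → 0ℚ ℚ.≤ c → a ℚ.≤ b → c ℚ.≤ d → a ℚ.* c ℚ.≤ b ℚ.* d
*-mono-≤ {a} {b} {c} {d} 0≤a 0≤c a≤b c≤d = ℚ.≤-trans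
  (ℚ.*-monoʳ-≤-nonNeg c {{ℚ.nonNegative 0≤c}} a≤b)
  (ℚ.*-monoˡ-≤-nonNeg b {{ℚ.nonNegative (ℚ.≤-trans 0≤a a≤b)}} c≤d)

^ᴿ-lower : ∀ (y : ℝ) s n → ι s ℚ.≤ seq y n → ∀ k → ι (s ^ k) ℚ.≤ seq (y ^ᴿ k) n
^ᴿ-lower y s n s≤y zero    = ℚ.≤-refl
^ᴿ-lower y s n s≤y (suc k) = ℚ.≤-trans (ℚ.≤-reflexive (sym (ι-* s (s ^ k))))
  (*-mono-≤ {ι s} {seq y n} {ι (s ^ k)} {seq (y ^ᴿ k) n} (0≤ι s) (0≤ι (s ^ k)) s≤y (^ᴿ-lower y s n s≤y k))

1/_! : ℕ → ℚ
1/ k ! = (+ 1 ℚ./ (k !)) {{k !≢0}}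

0≤1/k! : ∀ k → 0ℚ ℚ.≤ 1/ k !
0≤1/k! k = ℚ.<⇒≤ (ℚ.positive⁻¹ (1/ k !) {{ℚ.normalize-pos 1 (k !) {{k !≢0}}}})

seq-expSum : ∀ y K n → seq (expSum y K) n ≡ ∑ {K} (λ k → seq (y ^ᴿ toℕ k) n ℚ.* 1/ toℕ k !)
seq-expSum y K n = seq-∑ᴿ {K} (λ k → (y ^ᴿ toℕ k) *ᴿ fromℚ ((+ 1 ℚ./ (toℕ k !)) {{toℕ k !≢0}})) n

-- Only the term of index s = r + 1 is kept.
expSum-lower : ∀ (y : ℝ) r n → ι (suc r) ℚ.≤ seq y n → ∀ K → suc r ℕ.< K → ι (2 ^ r) ℚ.≤ seq (expSum y K) n
expSum-lower y r n s≤y K s<K = begin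
  ι (2 ^ r)                              ≡⟨ sym (ℚ.*-identityʳ (ι (2 ^ r))) ⟩
  ι (2 ^ r) ℚ.* 1ℚ                       ≡⟨ cong (ι (2 ^ r) ℚ.*_) (sym (trans (ℚ.*-comm (ι (s !)) (1/ s !)) (1/n*n (s !) {{s !≢0}}))) ⟩
  ι (2 ^ r) ℚ.* (ι (s !) ℚ.* 1/ s !)     ≡⟨ sym (ℚ.*-assoc (ι (2 ^ r)) (ι (s !)) (1/ s !)) ⟩
  ι (2 ^ r) ℚ.* ι (s !) ℚ.* 1/ s !       ≡⟨ cong (ℚ._* 1/ s !) (ι-* (2 ^ r) (s !)) ⟩
  ι (2 ^ r ℕ.* s !) ℚ.* 1/ s !           ≤⟨ ℚ.*-monoʳ-≤-nonNeg (1/ s !) {{ℚ.nonNegative (0≤1/k! s)}} (ι-mono-≤ (2^r*[1+r]!≤[1+r]^[1+r] r)) ⟩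
  ι (s ^ s) ℚ.* 1/ s !                   ≤⟨ ℚ.*-monoʳ-≤-nonNeg (1/ s !) {{ℚ.nonNegative (0≤1/k! s)}} (^ᴿ-lower y s n s≤y s) ⟩
  term s                                 ≡⟨ cong term (sym (toℕ-fromℕ< s<K)) ⟩
  term (toℕ (fromℕ< s<K))                ≤⟨ term≤∑ (λ (k : Fin K) → term (toℕ k)) (λ k → 0≤term (toℕ k)) (fromℕ< s<K) ⟩
  ∑ {K} (λ k → term (toℕ k))       ≡⟨ sym (seq-expSum y K n) ⟩
  seq (expSum y K) n                     ∎
  where
  open ℚ.≤-Reasoning
  s = suc r
  term : ℕ → ℚ
  term k = seq (y ^ᴿ k) n ℚ.* 1/ k !
  0≤term : ∀ k → 0ℚ ℚ.≤ term k
  0≤term k = ℚ.≤-trans (ℚ.≤-reflexive (sym (ℚ.*-zeroˡ (1/ k !))))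
    (ℚ.*-monoʳ-≤-nonNeg (1/ k !) {{ℚ.nonNegative (0≤1/k! k)}} (ℚ.≤-trans (0≤ι (s ^ k)) (^ᴿ-lower y s n s≤y k)))

0<1 : 0ᴿ <ᴿ 1ᴿ
0<1 = 1ℚ , ℚ.positive⁻¹ 1ℚ , 0 , λ n _ → ℚ.≤-refl

p≤∣p∣ : ∀ p → p ℚ.≤ ∣ p ∣
p≤∣p∣ p with 0ℚ ℚ.≤? p
... | yes 0≤p = ℚ.≤-reflexive (sym (ℚ.0≤p⇒∣p∣≡p 0≤p))
... | no  0≰p = ℚ.≤-trans (ℚ.<⇒≤ (ℚ.≰⇒> 0≰p)) (ℚ.0≤∣p∣ p)

∣p-q∣<r⇒p<q+r : ∀ {p q r} → ∣ p ℚ.- q ∣ ℚ.< r → p ℚ.< q ℚ.+ r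
∣p-q∣<r⇒p<q+r {p} {q} {r} d = subst (ℚ._< q ℚ.+ r) (solve 2 (λ p q → q :+ (p :- q) := p) refl p q)
  (ℚ.+-monoʳ-< q (ℚ.≤-<-trans (p≤∣p∣ (p ℚ.- q)) d))

module _ (ℓ x : ℝ) (a : ℕ) (isLog : ℓ IsLogOf x) (x≤2^a : ∃[ N ] (∀ n → N ℕ.≤ n → seq x n ℚ.≤ ι (2 ^ a))) where
  private
    settled = cauchy ℓ 1ℚ (ℚ.positive⁻¹ 1ℚ)
    M N K k : ℕ
    M = proj₁ settled
    N = proj₁ x≤2^a
    K = proj₁ (isLog 1ᴿ 0<1)
    -- Far enough for convergence, and long enough to contain the term of index a + 2.
    k = K ℕ.⊔ (4 ℕ.+ a)

    near : ∀ m n → M ℕ.≤ m → M ℕ.≤ n → seq ℓ m ℚ.< seq ℓ n ℚ.+ 1ℚ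
    near m n M≤m M≤n = ∣p-q∣<r⇒p<q+r {seq ℓ m} {seq ℓ n} (proj₂ settled m n M≤m M≤n)

    expSum<x+1 : expSum ℓ k <ᴿ x +ᴿ 1ᴿ
    expSum<x+1 = proj₂ (proj₂ (isLog 1ᴿ 0<1) k (ℕ.m≤m⊔n K (4 ℕ.+ a)))
    ε : ℚ
    ε = proj₁ expSum<x+1
    P : ℕ
    P = proj₁ (proj₂ (proj₂ expSum<x+1))

    too-small : ι (3 ℕ.+ a) ℚ.< seq ℓ M → ∀ n → M ℕ.≤ n → ι (2 ^ suc a) ℚ.≤ seq (expSum ℓ k) n
    too-small ℓM> n M≤n = expSum-lower ℓ (suc a) n large k (ℕ.≤-trans (ℕ.n≤1+n (3 ℕ.+ a)) (ℕ.m≤n⊔m K (4 ℕ.+ a)))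
      where
      large : ι (2 ℕ.+ a) ℚ.≤ seq ℓ n
      large = ℚ.≮⇒≥ λ ℓn< → <⇒≱
        (ℚ.≤-<-trans (ℚ.≤-reflexive (ι-suc (2 ℕ.+ a))) (ℚ.<-trans ℓM> (near M n ℕ.≤-refl M≤n)))
        (ℚ.+-monoˡ-≤ 1ℚ (ℚ.<⇒≤ ℓn<))

    too-big : ∀ n → N ℕ.≤ n → P ℕ.≤ n → seq (expSum ℓ k) n ℚ.< ι (2 ^ suc a)
    too-big n N≤n P≤n = begin-strict
      e                  ≡⟨ sym (ℚ.+-identityʳ e) ⟩
      e ℚ.+ 0ℚ           <⟨ ℚ.+-monoʳ-< e (proj₁ (proj₂ expSum<x+1)) ⟩
      e ℚ.+ ε            ≤⟨ proj₂ (proj₂ (proj₂ expSum<x+1)) n P≤n ⟩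
      seq x n ℚ.+ 1ℚ     ≤⟨ ℚ.+-monoˡ-≤ 1ℚ (proj₂ x≤2^a n N≤n) ⟩
      ι (2 ^ a) ℚ.+ 1ℚ   ≡⟨ ι-suc (2 ^ a) ⟩
      ι (suc (2 ^ a))    ≤⟨ ι-mono-≤ (ℕ.+-mono-≤ (ℕ.m^n>0 2 a) (ℕ.≤-reflexive (sym (ℕ.+-identityʳ (2 ^ a))))) ⟩
      ι (2 ^ suc a)      ∎
      where
      open ℚ.≤-Reasoning
      e = seq (expSum ℓ k) n

  -- If ℓ were at least a + 2, the term of that index would push the partial sum to 2^(a+1) ≥ x + 1.
  -- The other 2 in the constant 4 is the oscillation of ℓ past M, by less than 1 in either
  -- direction.
  log-upper : ∃[ N ] (∀ n → N ℕ.≤ n → seq ℓ n ℚ.≤ ι (4 ℕ.+ a))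
  log-upper = M , λ n M≤n → ℚ.≤-trans (ℚ.<⇒≤ (near n M M≤n ℕ.≤-refl))
    (ℚ.≤-trans (ℚ.+-monoˡ-≤ 1ℚ ℓM≤) (ℚ.≤-reflexive (ι-suc (3 ℕ.+ a))))
    where
    n = M ℕ.⊔ (N ℕ.⊔ P)
    ℓM≤ : seq ℓ M ℚ.≤ ι (3 ℕ.+ a)
    ℓM≤ = ℚ.≮⇒≥ λ ℓM> → <⇒≱
      (too-big n (ℕ.≤-trans (ℕ.m≤m⊔n N P) (ℕ.m≤n⊔m M (N ℕ.⊔ P))) (ℕ.≤-trans (ℕ.m≤n⊔m N P) (ℕ.m≤n⊔m M (N ℕ.⊔ P))))
      (too-small ℓM> n (ℕ.m≤m⊔n M (N ℕ.⊔ P)))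

-- Means

∑-mono-≤ᴿ : ∀ {N} (a : Fin N → ℚ) (F : Fin N → ℝ) → (∀ k → fromℚ (a k) ≤ᴿ F k) → fromℚ (∑ a) ≤ᴿ ∑ᴿ F
∑-mono-≤ᴿ {zero}  a F a≤F ε 0<ε = 0 , λ n _ → subst (0ℚ ℚ.<_) (sym (ℚ.+-identityˡ ε)) 0<ε
∑-mono-≤ᴿ {suc N} a F a≤F ε 0<ε =
  let M , head = a≤F zero (½ ℚ.* ε) (half-pos 0<ε)
      P , tail = ∑-mono-≤ᴿ (a ∘ suc) (F ∘ suc) (a≤F ∘ suc) (½ ℚ.* ε) (half-pos 0<ε)
  in M ℕ.⊔ P , λ n M⊔P≤n → ℚ.<-≤-trans
    (ℚ.+-mono-< (head n (⊔-≤ˡ {M} {P} M⊔P≤n)) (tail n (⊔-≤ʳ {M} {P} M⊔P≤n)))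
    (ℚ.≤-reflexive (regroup (seq (F zero) n) (seq (∑ᴿ (F ∘ suc)) n)))
  where
  regroup : ∀ x y → (x ℚ.+ ½ ℚ.* ε) ℚ.+ (y ℚ.+ ½ ℚ.* ε) ≡ (x ℚ.+ y) ℚ.+ ε
  regroup x y = trans (solve 3 (λ x y h → (x :+ h) :+ (y :+ h) := (x :+ y) :+ (h :+ h)) refl x y (½ ℚ.* ε))
    (cong (x ℚ.+ y ℚ.+_) (halves ε))

∑-complement : ∀ {N} (p : Fin N → Bool) → ∑ (λ k → indicator (not (p k))) ≡ ι N ℚ.- ι (count p)
∑-complement {zero}  p = refl
∑-complement {suc N} p with p zero
... | true  = trans (cong (0ℚ ℚ.+_) (∑-complement (p ∘ suc))) (trans
  (solve 2 (λ n c → con 0ℚ :+ (n :- c) := (n :+ con 1ℚ) :- (c :+ con 1ℚ)) refl (ι N) (ι (count (p ∘ suc))))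
  (cong₂ ℚ._-_ (ι-suc N) (ι-suc (count (p ∘ suc)))))
... | false = trans (cong (1ℚ ℚ.+_) (∑-complement (p ∘ suc))) (trans
  (solve 2 (λ n c → con 1ℚ :+ (n :- c) := (n :+ con 1ℚ) :- c) refl (ι N) (ι (count (p ∘ suc))))
  (cong (ℚ._- ι (count (p ∘ suc))) (ι-suc N)))

1/n-pos : ∀ n .{{_ : ℕ.NonZero n}} → ℚ.Positive (+ 1 ℚ./ n)
1/n-pos n = ℚ.normalize-pos 1 n

fraction≤step : ∀ N .{{_ : ℕ.NonZero N}} c n → c ℕ.* suc n ℕ.≤ N → (+ 1 ℚ./ N) ℚ.* ι c ℚ.≤ step n
fraction≤step N c n cn≤N = begin
  1/N ℚ.* ι c                          ≡⟨ cong (1/N ℚ.*_) (sym (ℕ*step c n)) ⟩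
  1/N ℚ.* (ι (c ℕ.* suc n) ℚ.* step n) ≡⟨ sym (ℚ.*-assoc 1/N (ι (c ℕ.* suc n)) (step n)) ⟩
  1/N ℚ.* ι (c ℕ.* suc n) ℚ.* step n   ≤⟨ ℚ.*-monoʳ-≤-nonNeg (step n) {{ℚ.pos⇒nonNeg (step n) {{step-pos n}}}}
                                            (ℚ.*-monoˡ-≤-nonNeg 1/N {{ℚ.pos⇒nonNeg 1/N {{1/n-pos N}}}} (ι-mono-≤ cn≤N)) ⟩
  1/N ℚ.* ι N ℚ.* step n               ≡⟨ cong (ℚ._* step n) (1/n*n N) ⟩
  1ℚ ℚ.* step n                        ≡⟨ ℚ.*-identityˡ (step n) ⟩
  step n                               ∎
  where
  open ℚ.≤-Reasoning
  1/N = + 1 ℚ./ N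

module _ (N : ℕ) .{{_ : ℕ.NonZero N}} (F : Fin N → ℝ) (bad : Fin N → Bool)
         (0≤F : ∀ k → 0ᴿ ≤ᴿ F k) (1≤F : ∀ k → bad k ≡ false → 1ᴿ ≤ᴿ F k)
         (n : ℕ) (rare : count bad ℕ.* suc n ℕ.≤ N)
         where
  private
    1/N : ℚ
    1/N = + 1 ℚ./ N

    value : Fin N → ℚ
    value k = indicator (not (bad k))

    value≤F : ∀ k → fromℚ (value k) ≤ᴿ F k
    value≤F k with bad k in bk
    ... | true  = 0≤F k
    ... | false = 1≤F k bk

    1/N*∑value : 1ℚ ℚ.- step n ℚ.≤ 1/N ℚ.* ∑ value
    1/N*∑value = begin
      1ℚ ℚ.- step n                         ≤⟨ ℚ.+-monoʳ-≤ 1ℚ (ℚ.neg-antimono-≤ (fraction≤step N (count bad) n rare)) ⟩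
      1ℚ ℚ.- 1/N ℚ.* ι (count bad)          ≡⟨ cong (ℚ._- 1/N ℚ.* ι (count bad)) (sym (1/n*n N)) ⟩
      1/N ℚ.* ι N ℚ.- 1/N ℚ.* ι (count bad) ≡⟨ solve 3 (λ r m c → r :* m :- r :* c := r :* (m :- c)) refl 1/N (ι N) (ι (count bad)) ⟩
      1/N ℚ.* (ι N ℚ.- ι (count bad))       ≡⟨ cong (1/N ℚ.*_) (sym (∑-complement bad)) ⟩
      1/N ℚ.* ∑ value                       ∎
      where open ℚ.≤-Reasoning

  -- F dominates the indicator of the good indices, whose mean is 1 minus the proportion of bad
  -- ones.
  mean-lower : ∀ η → 0ℚ ℚ.< η → ∃[ M ] (∀ m → M ℕ.≤ m → 1ℚ ℚ.- step n ℚ.≤ seq (mean N F) m ℚ.+ η)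
  mean-lower η 0<η =
    -- The sum may be off by N η, which the factor 1/N turns into η.
    let M , close = ∑-mono-≤ᴿ value F value≤F (ι N ℚ.* η) 0<Nη
    in M , λ m M≤m → ℚ.≤-trans 1/N*∑value (ℚ.≤-trans
      (ℚ.*-monoˡ-≤-nonNeg 1/N {{ℚ.pos⇒nonNeg 1/N {{1/n-pos N}}}} (ℚ.<⇒≤ (close m M≤m)))
      (ℚ.≤-reflexive (expand (seq (∑ᴿ F) m))))
    where
    0<Nη : 0ℚ ℚ.< ι N ℚ.* η
    0<Nη = ℚ.positive⁻¹ (ι N ℚ.* η) {{ℚ.pos*pos⇒pos (ι N) {{ℚ.positive (ι-mono-< (ℕ.>-nonZero⁻¹ N))}} η {{ℚ.positive 0<η}}}}
    expand : ∀ s → 1/N ℚ.* (s ℚ.+ ι N ℚ.* η) ≡ 1/N ℚ.* s ℚ.+ η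
    expand s = trans (solve 4 (λ r s m h → r :* (s :+ m :* h) := r :* s :+ (r :* m) :* h) refl 1/N s (ι N) η)
      (trans (cong (λ u → 1/N ℚ.* s ℚ.+ u ℚ.* η) (1/n*n N)) (cong (1/N ℚ.* s ℚ.+_) (ℚ.*-identityˡ η)))

  mean-close-to-1 : ∀ δ (0<δ : 0ᴿ <ᴿ δ) → step n ℚ.≤ ½ ℚ.* (½ ℚ.* proj₁ 0<δ) → 1ᴿ -ᴿ δ <ᴿ mean N F
  mean-close-to-1 δ (e , 0<e , P , e≤δ) small =
    let M , lower = mean-lower η (half-pos (half-pos 0<e))
    in ½ ℚ.* e , half-pos 0<e , M ℕ.⊔ P , λ m M⊔P≤m →
      conclude (seq δ m) (seq (mean N F) m) (e≤δ m (⊔-≤ʳ {M} {P} M⊔P≤m)) (lower m (⊔-≤ˡ {M} {P} M⊔P≤m))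
    where
    -- The margin e is spent as e/4 on the bad indices, e/4 on the error η, and e/2 as the gap of
    -- the strict inequality.
    η = ½ ℚ.* (½ ℚ.* e)
    conclude : ∀ d x → 0ℚ ℚ.+ e ℚ.≤ d → 1ℚ ℚ.- step n ℚ.≤ x ℚ.+ η → (1ℚ ℚ.- d) ℚ.+ ½ ℚ.* e ℚ.≤ x
    conclude d x e≤d lower = begin
      (1ℚ ℚ.- d) ℚ.+ ½ ℚ.* e              ≤⟨ ℚ.+-monoˡ-≤ (½ ℚ.* e) (ℚ.+-monoʳ-≤ 1ℚ (ℚ.neg-antimono-≤ e≤d)) ⟩
      (1ℚ ℚ.- (0ℚ ℚ.+ e)) ℚ.+ ½ ℚ.* e     ≡⟨ solve 1 (λ e → (con 1ℚ :- (con 0ℚ :+ e)) :+ con ½ :* e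
                                               := (con 1ℚ :- con ½ :* (con ½ :* e)) :- con ½ :* (con ½ :* e)) refl e ⟩
      (1ℚ ℚ.- η) ℚ.- η                    ≤⟨ ℚ.+-monoˡ-≤ (ℚ.- η) (ℚ.+-monoʳ-≤ 1ℚ (ℚ.neg-antimono-≤ small)) ⟩
      (1ℚ ℚ.- step n) ℚ.- η               ≤⟨ ℚ.+-monoˡ-≤ (ℚ.- η) lower ⟩
      (x ℚ.+ η) ℚ.- η                     ≡⟨ solve 2 (λ x h → (x :+ h) :- h := x) refl x η ⟩
      x                                   ∎
      where open ℚ.≤-Reasoning

-- Tensor powers of the representation of A₄

funToFin-cong : ∀ {m n} {f g : Fin m → Fin n} → (∀ i → f i ≡ g i) → funToFin f ≡ funToFin g
funToFin-cong {zero}  f≗g = refl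
funToFin-cong {suc m} f≗g = cong₂ combine (f≗g zero) (funToFin-cong (f≗g ∘ suc))

finToFun-injective : ∀ {m n} {k l : Fin (n ^ m)} → (∀ i → finToFun {n} {m} k i ≡ finToFun l i) → k ≡ l
finToFun-injective {m} {n} {k} {l} e =
  trans (sym (funToFin-finToFin {m} {n} k)) (trans (funToFin-cong {m} {n} e) (funToFin-finToFin {m} {n} l))

A₄^ : ℕ → FiniteGroup
A₄^ m = record
  { group = record
    { Carrier = Fin m → A₄
    ; _≈_     = λ g h → ∀ j → g j ≡ h j
    ; _∙_     = λ g h j → g j · h j
    ; ε       = λ _ → zero
    ; _⁻¹     = λ g j → inv (g j)
    ; isGroup = record
      { isMonoid = record
        { isSemigroup = record
          { isMagma = record
            { isEquivalence = record
              { refl  = λ _ → refl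
              ; sym   = λ e j → sym (e j)
              ; trans = λ e e′ j → trans (e j) (e′ j)
              }
            ; ∙-cong = λ e e′ j → cong₂ _·_ (e j) (e′ j)
            }
          ; assoc = λ g h k j → ·-assoc (g j) (h j) (k j)
          }
        ; identity = (λ g j → ·-identityˡ (g j)) , (λ g j → ·-identityʳ (g j))
        }
      ; inverse = (λ g j → ·-inverseˡ (g j)) , (λ g j → ·-inverseʳ (g j))
      ; ⁻¹-cong = λ e j → cong inv (e j)
      }
    }
  ; order = 12 ^ m
  ; enumeration = record
    { to        = finToFun
    ; from      = funToFin
    ; to-cong   = λ { refl j → refl }
    ; from-cong = funToFin-cong
    ; inverse   = (λ { {g} refl j → finToFun-funToFin g j })
                , (λ {k} e → trans (funToFin-cong e) (funToFin-finToFin {m} {12} k))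
    }
  }

-- The basis tensor e_(y₀) ⊗ e_(y₁) ⊗ ... is numbered by its base-3 digits.
axes : ∀ {m} → Fin (3 ^ m) → Fin m → Fin 3
axes = finToFun

tensorAction : ∀ m → SignedAction (A₄^ m) (3 ^ m)
tensorAction m = record
  { act      = λ g y → funToFin (λ j → move (g j) (axes y j))
  ; neg      = λ g y → parity (λ j → negates (g j) (axes y j))
  ; act-cong = λ e y → funToFin-cong λ j → cong (λ k → move k (axes y j)) (e j)
  ; neg-cong = λ e y → parity-cong λ j → cong (λ k → negates k (axes y j)) (e j)
  ; act-∙    = λ g h y → funToFin-cong λ j → trans (move-· (g j) (h j) (axes y j))
      (cong (move (g j)) (sym (finToFun-funToFin (λ j → move (h j) (axes y j)) j)))
  ; act-ε    = λ y → trans (funToFin-cong {m} λ j → move-identity (axes {m} y j)) (funToFin-finToFin {m} {3} y)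
  ; neg-∙    = λ g h y → trans
      (parity-cong λ j → trans (negates-· (g j) (h j) (axes y j))
        (cong (λ z → negates (h j) (axes y j) xor negates (g j) z)
          (sym (finToFun-funToFin (λ j → move (h j) (axes y j)) j))))
      (parity-distrib-xor (λ j → negates (h j) (axes y j)) _)
  }

tensorRep : ∀ m → UnitaryRep (A₄^ m)
tensorRep m = rep (tensorAction m)

axes-≢ : ∀ {m} {x y : Fin (3 ^ m)} → x ≢ y → ∃[ j ] axes {m} x j ≢ axes y j
axes-≢ {m} {x} {y} x≢y with any? (λ j → ¬? (axes {m} x j ≟ axes y j))
... | yes differ = differ
... | no ¬differ = contradiction (finToFun-injective {m} agree) x≢y
  where
  agree : ∀ j → axes {m} x j ≡ axes y j
  agree j with axes {m} x j ≟ axes y j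
  ... | yes e = e
  ... | no ≢ = contradiction (j , ≢) ¬differ

-- Irreducibility and nontriviality of the tensor powers

module _ {m : ℕ} where
  open SignedAction (tensorAction m) using (act; neg)

  -- An element of V placed in one tensor factor. Two different basis tensors differ in some factor,
  -- where such an element tells them apart by its sign.
  flipAt : Fin m × Fin 4 → Fin m → A₄
  flipAt (j , v) i with i ≟ j
  ... | yes _ = flip v
  ... | no  _ = flip zero

  flipAt-fixes : ∀ jv y → act (flipAt jv) y ≡ y
  flipAt-fixes (j , v) y = trans (funToFin-cong fix) (funToFin-finToFin {m} {3} y)
    where
    fix : ∀ i → move (flipAt (j , v) i) (axes y i) ≡ axes y i
    fix i with i ≟ j
    ... | yes _ = move-flip v (axes y i)
    ... | no  _ = move-flip zero (axes y i)

  neg-flipAt : ∀ j v y → neg (flipAt (j , v)) y ≡ negates (flip v) (axes y j)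
  neg-flipAt j v y = trans (sum-single xor-commutativeMonoid (λ i → negates (flipAt (j , v) i) (axes y i)) j other) at-j
    where
    other : ∀ i → i ≢ j → negates (flipAt (j , v) i) (axes y i) ≡ false
    other i i≢j with i ≟ j
    ... | yes i≡j = contradiction i≡j i≢j
    ... | no  _   = negates-flip₀ (axes y i)
    at-j : negates (flipAt (j , v) j) (axes y j) ≡ negates (flip v) (axes y j)
    at-j with j ≟ j
    ... | yes _  = refl
    ... | no j≢j = contradiction refl j≢j

  flips-list : List (Fin m → A₄)
  flips-list = tabulate {n = m ℕ.* 4} (flipAt ∘ remQuot 4)

  flips-separate : ∀ x y → x ≢ y → Any (λ g → neg g x ≢ neg g y) flips-list
  flips-separate x y x≢y =
    let j , xj≢yj = axes-≢ {m} x≢y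
        v = suc (axes x j)
    in Any.tabulate⁺ (combine j v) (subst (λ jv → neg (flipAt jv) x ≢ neg (flipAt jv) y) (sym (remQuot-combine j v))
         λ e → flip-separates (axes x j) (axes y j) xj≢yj (trans (sym (neg-flipAt j v x)) (trans e (neg-flipAt j v y))))

  act-transitive : ∀ x y → ∃[ g ] act g x ≡ y
  act-transitive x y = (λ j → turn (axes {m} y j +₃ (-₃ axes {m} x j))) ,
    trans (funToFin-cong {m} λ j → move-turn (axes {m} x j) (axes {m} y j)) (funToFin-finToFin {m} {3} y)

tensorRep-irreducible : ∀ m → Irreducible (tensorRep m)
tensorRep-irreducible m = irreducible (tensorRep m) (tensorAction m) (rep-represents (tensorAction m))
  (ℕ.m^n≢0 3 m) (flips-list {m}) (All.tabulate⁺ λ k → flipAt-fixes {m} (remQuot {m} 4 k)) flips-separate act-transitive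

-- Turning every factor moves a basis tensor, which puts 0 on the diagonal where the identity has 1;
-- a first factor must exist to see the move.
tensorRep-nontrivial : ∀ m → Nontrivial (tensorRep (suc m))
tensorRep-nontrivial m trivial =
  let N , close = proj₁ (trivial g y y) 1ℚ (ℚ.positive⁻¹ 1ℚ)
  in ℚ.<-irrefl refl (subst₂ (λ p q → ∣ p ℚ.- q ∣ ℚ.< 1ℚ) (entry-miss g moves) (diagonal N) (close N ℕ.≤-refl))
  where
  open SignedAction (tensorAction (suc m)) using (act; entry-miss)
  g : Fin (suc m) → A₄
  g _ = turn 1F
  y : Fin (3 ^ suc m)
  y = funToFin {suc m} {3} (λ _ → 0F)
  moves : act g y ≢ y
  moves e = move-turn₁ (axes {suc m} y zero) (trans (sym (finToFun-funToFin (λ j → move (g j) (axes {suc m} y j)) zero))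
    (cong (λ z → axes {suc m} z zero) e))
  diagonal : ∀ n → seq (re (1ᴹ y y)) n ≡ 1ℚ
  diagonal n = trans (re-1ᴹ y y n) (cong (if_then 1ℚ else 0ℚ) (dec-true (y ≟ y) refl))

equitable? : ∀ {m T} (τ : Fin m → Fin T) y → Dec (Equitable τ y)
equitable? τ y = all? λ c → all? λ k → negations (λ j → does (τ j ≟ c)) k y Bool.≟ false

equitable-cong : ∀ {m T} (τ : Fin m → Fin T) {y z} → (∀ j → y j ≡ z j) → Equitable τ y → Equitable τ z
equitable-cong τ y≗z eq c k =
  trans (parity-cong λ j → cong (λ a → does (τ j ≟ c) ∧ negates k a) (sym (y≗z j))) (eq c k)

-- Columns of a tuple and the common fixed vector

module _ {m t : ℕ} (g : Fin t → Fin m → A₄) where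
  open SignedAction (tensorAction m) using (act; neg)

  column : Fin m → Fin (12 ^ t)
  column j = funToFin λ i → g i j

  private
    -- Entry i of a column value. Through it `g i` acts on factor j by a function of the value of
    -- column j, the form that `equitable-even` and `equitable-move` ask for.
    κ : Fin t → Fin (12 ^ t) → A₄
    κ i c = finToFun {12} {t} c i

    κ-column : ∀ i j → κ i (column j) ≡ g i j
    κ-column i j = finToFun-funToFin (λ i → g i j) i

    Fair : Fin (3 ^ m) → Set
    Fair y = Equitable column (axes {m} y)

    fair? : ∀ y → Dec (Fair y)
    fair? y = equitable? column (axes {m} y)

    moved : ∀ i y j → axes {m} (act (g i) y) j ≡ move (κ i (column j)) (axes {m} y j)
    moved i y j = trans (finToFun-funToFin (λ j → move (g i j) (axes {m} y j)) j)
      (cong (λ k → move k (axes {m} y j)) (sym (κ-column i j)))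

    fair-act : ∀ i y → Fair y → Fair (act (g i) y)
    fair-act i y fair = equitable-cong column (λ j → sym (moved i y j)) (equitable-move column fair (κ i))

    -- The support must be invariant as a Boolean function, so fairness has to be pulled back too;
    -- moving by the inverse entries does this.
    fair-act⁻¹ : ∀ i y → Fair (act (g i) y) → Fair y
    fair-act⁻¹ i y fair = equitable-cong column
      (λ j → trans (cong (move (inv (κ i (column j)))) (moved i y j)) (move-inverse (κ i (column j)) (axes {m} y j)))
      (equitable-move column fair (λ c → inv (κ i c)))

    fair-positive : ∀ i y → Fair y → neg (g i) y ≡ false
    fair-positive i y fair = trans (parity-cong λ j → cong (λ k → negates k (axes {m} y j)) (sym (κ-column i j)))
      (equitable-even column fair (κ i))

    does⇒ : ∀ {A : Set} (a? : Dec A) → does a? ≡ true → A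
    does⇒ (yes a) _ = a

  -- The fixed vector is the sum of all fair basis tensors. It is nonzero because, without lonely
  -- columns, `equitable-exists` supplies one.
  ¬lonely⇒1≤norm : .{{t≢0 : ℕ.NonZero t}} → ¬ Lonely column →
                    ∀ r → IsOperatorNorm (average (tensorRep m) t {{t≢0}} g) r → 1ᴿ ≤ᴿ r
  ¬lonely⇒1≤norm {{t≢0}} ¬lonely r isNorm =
    let y , fair = equitable-exists column (¬lonely⇒twins column ¬lonely)
    in 1≤norm-average (tensorRep m) (tensorAction m) (rep-represents (tensorAction m)) t {{t≢0}} g
         (λ y → does (fair? y))
         (λ i y → does-⇔ (mk⇔ (fair-act⁻¹ i y) (fair-act i y)) (fair? (act (g i) y)) (fair? y))
         (λ i y e → fair-positive i y (does⇒ (fair? y) e))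
         (funToFin y)
         (dec-true (fair? (funToFin y)) (equitable-cong column (λ j → sym (finToFun-funToFin y j)) fair))
         r isNorm

-- The bound on the expectation

tuple : ∀ m t → Fin ((12 ^ m) ^ t) → Fin t → Fin m → A₄
tuple m t k i = finToFun (finToFun {12 ^ m} {t} k i)

columns : ∀ m t → Fin ((12 ^ m) ^ t) → Fin m → Fin (12 ^ t)
columns m t k = column (tuple m t k)

columns-injective : ∀ m t k l → (∀ j → columns m t k j ≡ columns m t l j) → k ≡ l
columns-injective m t k l e = finToFun-injective {t} {12 ^ m} λ i → finToFun-injective {m} {12} λ j →
  funToFin-injective {t} {12} {λ i → tuple m t k i j} {λ i → tuple m t l i j} (e j) i

count-lonely′ : ∀ {N m T u} → T ≡ suc u → (τ : Fin N → Fin (suc m) → Fin T) →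
                (∀ k l → (∀ j → τ k j ≡ τ l j) → k ≡ l) →
                count (λ k → does (lonely? (τ k))) ℕ.≤ suc m ℕ.* (T ℕ.* u ^ m)
count-lonely′ refl = count-lonely

1+n≤2^n : ∀ n → suc n ℕ.≤ 2 ^ n
1+n≤2^n zero    = ℕ.≤-refl
1+n≤2^n (suc n) = ℕ.≤-trans (ℕ.+-mono-≤ (ℕ.m^n>0 2 n) (1+n≤2^n n))
  (ℕ.≤-reflexive (cong (2 ^ n ℕ.+_) (sym (ℕ.+-identityʳ (2 ^ n)))))

-- This is 4 r + 1 ≤ 2^r for r = 5 + s; it fails at r = 4, where 17 > 16.
21+4s≤2^[5+s] : ∀ s → 21 ℕ.+ 4 ℕ.* s ℕ.≤ 2 ^ (5 ℕ.+ s)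
21+4s≤2^[5+s] zero    = ℕ.m≤m+n 21 11
21+4s≤2^[5+s] (suc s) = begin
  21 ℕ.+ 4 ℕ.* suc s           ≡⟨ cong (21 ℕ.+_) (ℕ.*-suc 4 s) ⟩
  21 ℕ.+ (4 ℕ.+ 4 ℕ.* s)       ≡⟨ ℕ.+-comm 21 (4 ℕ.+ 4 ℕ.* s) ⟩
  4 ℕ.+ 4 ℕ.* s ℕ.+ 21         ≡⟨ trans (ℕ.+-assoc 4 (4 ℕ.* s) 21) (cong (4 ℕ.+_) (ℕ.+-comm (4 ℕ.* s) 21)) ⟩
  4 ℕ.+ (21 ℕ.+ 4 ℕ.* s)       ≤⟨ ℕ.+-mono-≤ (ℕ.≤-trans (ℕ.m≤m+n 4 28) (ℕ.^-monoʳ-≤ 2 (ℕ.m≤m+n 5 s))) (21+4s≤2^[5+s] s) ⟩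
  2 ^ (5 ℕ.+ s) ℕ.+ 2 ^ (5 ℕ.+ s)  ≡⟨ cong (2 ^ (5 ℕ.+ s) ℕ.+_) (sym (ℕ.+-identityʳ (2 ^ (5 ℕ.+ s)))) ⟩
  2 ^ (5 ℕ.+ suc s)            ∎
  where open ℕ.≤-Reasoning

-- For r = n - q one has n ≤ 2 r, so 2 n + 1 ≤ 4 r + 1 ≤ 2^r; the bound 10 ≤ n ensures r ≥ 5.
2^q*[2n+1]≤2^n : ∀ q n → 2 ℕ.* q ℕ.≤ n → 10 ℕ.≤ n → 2 ^ q ℕ.* suc (2 ℕ.* n) ℕ.≤ 2 ^ n
2^q*[2n+1]≤2^n q n 2q≤n 10≤n = begin
  2 ^ q ℕ.* suc (2 ℕ.* n)       ≤⟨ ℕ.*-monoʳ-≤ (2 ^ q) bound′ ⟩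
  2 ^ q ℕ.* 2 ^ r               ≡⟨ sym (ℕ.^-distribˡ-+-* 2 q r) ⟩
  2 ^ (q ℕ.+ r)                 ≡⟨ cong (2 ^_) q+r≡n ⟩
  2 ^ n                         ∎
  where
  open ℕ.≤-Reasoning
  r = n ℕ.∸ q
  q+q≤n : q ℕ.+ q ℕ.≤ n
  q+q≤n = ℕ.≤-trans (ℕ.≤-reflexive (cong (q ℕ.+_) (sym (ℕ.+-identityʳ q)))) 2q≤n
  q+r≡n : q ℕ.+ r ≡ n
  q+r≡n = ℕ.m+[n∸m]≡n (ℕ.≤-trans (ℕ.m≤m+n q q) q+q≤n)
  q≤r : q ℕ.≤ r
  q≤r = ℕ.+-cancelˡ-≤ q q r (ℕ.≤-trans q+q≤n (ℕ.≤-reflexive (sym q+r≡n)))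
  n≤2r : n ℕ.≤ 2 ℕ.* r
  n≤2r = ℕ.≤-trans (ℕ.≤-reflexive (sym q+r≡n)) (ℕ.+-mono-≤ q≤r (ℕ.≤-reflexive (sym (ℕ.+-identityʳ r))))
  5≤r : 5 ℕ.≤ r
  5≤r = ℕ.*-cancelˡ-≤ 2 (ℕ.≤-trans 10≤n n≤2r)
  s = r ℕ.∸ 5
  5+s≡r : 5 ℕ.+ s ≡ r
  5+s≡r = ℕ.m+[n∸m]≡n 5≤r
  bound′ : suc (2 ℕ.* n) ℕ.≤ 2 ^ r
  bound′ = begin
    suc (2 ℕ.* n)                 ≤⟨ s≤s (ℕ.*-monoʳ-≤ 2 n≤2r) ⟩
    suc (2 ℕ.* (2 ℕ.* r))         ≡⟨ cong suc (sym (ℕ.*-assoc 2 2 r)) ⟩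
    suc (4 ℕ.* r)                 ≡⟨ cong (λ r → suc (4 ℕ.* r)) (sym 5+s≡r) ⟩
    suc (4 ℕ.* (5 ℕ.+ s))         ≡⟨ cong suc (ℕ.*-distribˡ-+ 4 5 s) ⟩
    21 ℕ.+ 4 ℕ.* s                ≤⟨ 21+4s≤2^[5+s] s ⟩
    2 ^ (5 ℕ.+ s)                 ≡⟨ cong (2 ^_) 5+s≡r ⟩
    2 ^ r                         ∎

12^k≤2^[4k] : ∀ k → 12 ^ k ℕ.≤ 2 ^ (4 ℕ.* k)
12^k≤2^[4k] k = ℕ.≤-trans (ℕ.^-monoˡ-≤ k (ℕ.m≤m+n 12 4)) (ℕ.≤-reflexive (ℕ.^-*-assoc 2 4 k))

-- Of T^m tuples at most m T u^M are lonely, where M = m - 1 = 2^n. The factor m (n + 1) ≤ 2^(2n+1)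
-- is absorbed by (T/u)^M, since M contains 2 n + 1 blocks of length u < 12^t ≤ 2^(4t) ≤ 2^(n/2).
lonely-rare : ∀ t n → .{{_ : NonZero t}} → 8 ℕ.* t ℕ.≤ n → 10 ℕ.≤ n →
  count (λ k → does (lonely? (columns (suc (2 ^ n)) t k))) ℕ.* suc n ℕ.≤ (12 ^ suc (2 ^ n)) ^ t
lonely-rare t n 8t≤n 10≤n = begin
  count (λ k → does (lonely? (columns m t k))) ℕ.* suc n
    ≤⟨ ℕ.*-monoˡ-≤ (suc n) (count-lonely′ T≡1+u (columns m t) (columns-injective m t)) ⟩
  m ℕ.* (T ℕ.* u ^ M) ℕ.* suc n
    ≡⟨ rearrange m T (u ^ M) (suc n) ⟩
  T ℕ.* (m ℕ.* suc n ℕ.* u ^ M)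
    ≤⟨ ℕ.*-monoʳ-≤ T (ℕ.*-monoˡ-≤ (u ^ M) (ℕ.*-mono-≤ m≤2^[1+n] (1+n≤2^n n))) ⟩
  T ℕ.* (2 ^ suc n ℕ.* 2 ^ n ℕ.* u ^ M)
    ≡⟨ cong (λ a → T ℕ.* (a ℕ.* u ^ M)) (sym (ℕ.^-distribˡ-+-* 2 (suc n) n)) ⟩
  T ℕ.* (2 ^ (suc n ℕ.+ n) ℕ.* u ^ M)
    ≡⟨ cong (λ e → T ℕ.* (2 ^ suc e ℕ.* u ^ M)) (cong (n ℕ.+_) (sym (ℕ.+-identityʳ n))) ⟩
  T ℕ.* (2 ^ suc (2 ℕ.* n) ℕ.* u ^ M)
    ≤⟨ ℕ.*-monoʳ-≤ T (2^e*u^M≤[1+u]^M u {{u≢0}} (suc (2 ℕ.* n)) M u*e≤M) ⟩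
  T ℕ.* suc u ^ M
    ≡⟨ cong (λ x → T ℕ.* x ^ M) (sym T≡1+u) ⟩
  T ^ m
    ≡⟨ trans (ℕ.^-*-assoc 12 t m) (trans (cong (12 ^_) (ℕ.*-comm t m)) (sym (ℕ.^-*-assoc 12 m t))) ⟩
  (12 ^ m) ^ t ∎
  where
  open ℕ.≤-Reasoning
  M = 2 ^ n
  m = suc M
  T = 12 ^ t
  u = ℕ.pred T
  T≡1+u : T ≡ suc u
  T≡1+u = sym (ℕ.suc-pred T {{ℕ.m^n≢0 12 t}})
  12≤T : 12 ℕ.≤ T
  12≤T = ℕ.≤-trans (ℕ.≤-reflexive (sym (ℕ.^-identityʳ 12))) (ℕ.^-monoʳ-≤ 12 (ℕ.>-nonZero⁻¹ t))
  u≢0 : NonZero u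
  u≢0 = ℕ.>-nonZero (ℕ.≤-pred (ℕ.≤-trans (ℕ.≤-trans (ℕ.m≤m+n 2 10) 12≤T) (ℕ.≤-reflexive T≡1+u)))
  u*e≤M : u ℕ.* suc (2 ℕ.* n) ℕ.≤ M
  u*e≤M = ℕ.≤-trans
    (ℕ.*-monoˡ-≤ (suc (2 ℕ.* n)) (ℕ.≤-trans (ℕ.≤-trans (ℕ.n≤1+n u) (ℕ.≤-reflexive (sym T≡1+u))) (12^k≤2^[4k] t)))
    (2^q*[2n+1]≤2^n (4 ℕ.* t) n (ℕ.≤-trans (ℕ.≤-reflexive (sym (ℕ.*-assoc 2 4 t))) 8t≤n) 10≤n)
  m≤2^[1+n] : m ℕ.≤ 2 ^ suc n
  m≤2^[1+n] = ℕ.+-mono-≤ (ℕ.m^n>0 2 n) (ℕ.≤-reflexive (sym (ℕ.+-identityʳ M)))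
  rearrange : ∀ a b c d → a ℕ.* (b ℕ.* c) ℕ.* d ≡ b ℕ.* (a ℕ.* d ℕ.* c)
  rearrange a b c d = trans (cong (ℕ._* d) (trans (sym (ℕ.*-assoc a b c)) (trans (cong (ℕ._* c) (ℕ.*-comm a b)) (ℕ.*-assoc b a c))))
    (trans (ℕ.*-assoc b (a ℕ.* c) d) (cong (b ℕ.*_)
      (trans (ℕ.*-assoc a c d) (trans (cong (a ℕ.*_) (ℕ.*-comm c d)) (sym (ℕ.*-assoc a d c))))))

-- Comparison of t with log log |G_n|

order≤ : ∀ n → 12 ^ suc (2 ^ n) ℕ.≤ 2 ^ (2 ^ (3 ℕ.+ n))
order≤ n = ℕ.≤-trans (12^k≤2^[4k] (suc (2 ^ n))) (ℕ.^-monoʳ-≤ 2 (begin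
  4 ℕ.* suc (2 ^ n)                ≤⟨ ℕ.*-monoʳ-≤ 4 (ℕ.+-mono-≤ (ℕ.m^n>0 2 n) (ℕ.≤-reflexive (sym (ℕ.+-identityʳ (2 ^ n))))) ⟩
  4 ℕ.* (2 ℕ.* 2 ^ n)              ≡⟨ ℕ.*-assoc 2 2 (2 ℕ.* 2 ^ n) ⟩
  2 ^ (3 ℕ.+ n)                    ∎))
  where open ℕ.≤-Reasoning

-- Chosen since log log |G_n| ≤ n + 8 ≤ 2 n for n ≥ 10, which turns t ≤ (log log |G_n|)/16 into 8 t
-- ≤ n.
1/16 : ℚ
1/16 = + 1 ℚ./ 16

module _ (n : ℕ) (L LL : ℝ) (isLog : L IsLogOf fromℕ (12 ^ suc (2 ^ n))) (isLogLog : LL IsLogOf L) where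
  private
    L≤ : ∃[ P ] (∀ k → P ℕ.≤ k → seq L k ℚ.≤ ι (2 ^ (4 ℕ.+ n)))
    L≤ = let P , h = log-upper L (fromℕ (12 ^ suc (2 ^ n))) (2 ^ (3 ℕ.+ n)) isLog (0 , λ _ _ → ι-mono-≤ (order≤ n))
         in P , λ k P≤k → ℚ.≤-trans (h k P≤k) (ι-mono-≤ absorb)
      where
      absorb : 4 ℕ.+ 2 ^ (3 ℕ.+ n) ℕ.≤ 2 ^ (4 ℕ.+ n)
      absorb = ℕ.+-mono-≤ (ℕ.≤-trans (ℕ.m≤m+n 4 4) (ℕ.^-monoʳ-≤ 2 (ℕ.m≤m+n 3 n)))
        (ℕ.≤-reflexive (sym (ℕ.+-identityʳ (2 ^ (3 ℕ.+ n)))))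

    -- Each use of `log-upper` costs 4: log |G_n| ≤ 4 + 2^(n+3) ≤ 2^(n+4), then log log |G_n| ≤ 4 +
    -- (n + 4).
    LL≤ : ∃[ P ] (∀ k → P ℕ.≤ k → seq LL k ℚ.≤ ι (8 ℕ.+ n))
    LL≤ = log-upper LL L (4 ℕ.+ n) isLogLog L≤

  16t≤8+n : ∀ t → fromℕ t ≤ᴿ fromℚ 1/16 *ᴿ LL → 16 ℕ.* t ℕ.≤ 8 ℕ.+ n
  16t≤8+n t t≤cLL =
    -- Scaled by 16 the tolerance 1/16 becomes 1, and 16 t < 9 + n means 16 t ≤ 8 + n for integers.
    let P , h = t≤cLL 1/16 (ℚ.positive⁻¹ 1/16)
        Q , h′ = LL≤
    in ℕ.≤-pred (ι-cancel-< (scaled (seq LL (P ℕ.⊔ Q)) (h (P ℕ.⊔ Q) (ℕ.m≤m⊔n P Q)) (h′ (P ℕ.⊔ Q) (ℕ.m≤n⊔m P Q))))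
    where
    scaled : ∀ x → ι t ℚ.< 1/16 ℚ.* x ℚ.+ 1/16 → x ℚ.≤ ι (8 ℕ.+ n) → ι (16 ℕ.* t) ℚ.< ι (9 ℕ.+ n)
    scaled x t< x≤ = begin-strict
      ι (16 ℕ.* t)                         ≡⟨ sym (ι-* 16 t) ⟩
      ι 16 ℚ.* ι t                         <⟨ ℚ.*-monoʳ-<-pos (ι 16) t< ⟩
      ι 16 ℚ.* (1/16 ℚ.* x ℚ.+ 1/16)       ≡⟨ solve 1 (λ x → con (ι 16) :* (con 1/16 :* x :+ con 1/16) := x :+ con 1ℚ) refl x ⟩
      x ℚ.+ 1ℚ                             ≤⟨ ℚ.+-monoˡ-≤ 1ℚ x≤ ⟩
      ι (8 ℕ.+ n) ℚ.+ 1ℚ                   ≡⟨ ι-suc (8 ℕ.+ n) ⟩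
      ι (9 ℕ.+ n)                          ∎
      where open ℚ.≤-Reasoning

8t≤n : ∀ t n → 10 ℕ.≤ n → 16 ℕ.* t ℕ.≤ 8 ℕ.+ n → 8 ℕ.* t ℕ.≤ n
8t≤n t n 10≤n 16t≤ = ℕ.*-cancelˡ-≤ 2 (begin
  2 ℕ.* (8 ℕ.* t)    ≡⟨ sym (ℕ.*-assoc 2 8 t) ⟩
  16 ℕ.* t           ≤⟨ 16t≤ ⟩
  8 ℕ.+ n            ≤⟨ ℕ.+-monoˡ-≤ n (ℕ.≤-trans (ℕ.m≤m+n 8 2) 10≤n) ⟩
  n ℕ.+ n            ≡⟨ cong (n ℕ.+_) (sym (ℕ.+-identityʳ n)) ⟩
  2 ℕ.* n            ∎)
  where open ℕ.≤-Reasoning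

n≤order : ∀ n → n ℕ.≤ 12 ^ suc (2 ^ n)
n≤order n = begin
  n                      ≤⟨ ℕ.n≤1+n n ⟩
  suc n                  ≤⟨ 1+n≤2^n n ⟩
  2 ^ n                  ≤⟨ ℕ.m≤n+m (2 ^ n) 2 ⟩
  suc (suc (2 ^ n))      ≤⟨ 1+n≤2^n (suc (2 ^ n)) ⟩
  2 ^ suc (2 ^ n)        ≤⟨ ℕ.^-monoˡ-≤ (suc (2 ^ n)) (ℕ.m≤m+n 2 10) ⟩
  12 ^ suc (2 ^ n)       ∎
  where open ℕ.≤-Reasoning

module _ (m n t : ℕ) .{{t≢0 : NonZero t}}
         (rare : count (λ k → does (lonely? (columns m t k))) ℕ.* suc n ℕ.≤ (12 ^ m) ^ t)
         (norm : (Fin t → Fin m → A₄) → ℝ)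
         (isNorm : ∀ g → IsOperatorNorm (average (tensorRep m) t {{t≢0}} g) (norm g))
         where
  private
    does⇒¬ : ∀ {A : Set} (a? : Dec A) → does a? ≡ false → ¬ A
    does⇒¬ (no ¬a) _ = ¬a

    1≤norm : ∀ k → does (lonely? (columns m t k)) ≡ false → 1ᴿ ≤ᴿ norm (tuple m t k)
    1≤norm k e = ¬lonely⇒1≤norm (tuple m t k) {{t≢0}} (does⇒¬ (lonely? (columns m t k)) e)
      (norm (tuple m t k)) (isNorm (tuple m t k))

  expectation-close-to-1 : ∀ δ (0<δ : 0ᴿ <ᴿ δ) → step n ℚ.≤ ½ ℚ.* (½ ℚ.* proj₁ 0<δ) → 1ᴿ -ᴿ δ <ᴿ 𝔼 (A₄^ m) t norm
  expectation-close-to-1 = mean-close-to-1 ((12 ^ m) ^ t) {{ℕ.m^n≢0 (12 ^ m) t {{ℕ.m^n≢0 12 m}}}}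
    (λ k → norm (tuple m t k)) (λ k → does (lonely? (columns m t k)))
    (λ k → IsOperatorNorm.nonNeg (isNorm (tuple m t k))) 1≤norm n rare

mainTheorem3 : Σ (ℕ → FiniteGroup) λ G → Σ (∀ n → UnitaryRep (G n)) λ ρ →
    (∀ n → Irreducible (ρ n) × Nontrivial (ρ n)) ×
    (∀ K → ∃[ N ] (∀ n → N ≤ n → K ≤ FiniteGroup.order (G n))) ×
    (∀ δ → 0ᴿ <ᴿ δ →
    ∃[ c ] (0ᴿ <ᴿ c × ∃[ N ] (∀ n → N ≤ n →
    ∀ t → .{{_ : NonZero t}} →
    ∀ L LL → L IsLogOf fromℕ (FiniteGroup.order (G n)) → LL IsLogOf L →
    fromℕ t ≤ᴿ c *ᴿ LL →
    ∀ (‖avg‖ : (Fin t → FiniteGroup.Carrier (G n)) → ℝ) →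
    (∀ g → IsOperatorNorm (average (ρ n) t g) (‖avg‖ g)) →
    1ᴿ -ᴿ δ <ᴿ 𝔼 (G n) t ‖avg‖)))
mainTheorem3 =
    (λ n → A₄^ (suc (2 ^ n)))
  , (λ n → tensorRep (suc (2 ^ n)))
  , (λ n → tensorRep-irreducible (suc (2 ^ n)) , tensorRep-nontrivial (2 ^ n))
  , (λ K → K , λ n K≤n → ℕ.≤-trans K≤n (n≤order n))
  , λ δ 0<δ →
      -- One constant c serves all δ; only the threshold depends on δ, through 1/(n + 1) ≤ e/4 for
      -- the rational margin e of δ.
      let N , small = step-small (½ ℚ.* (½ ℚ.* proj₁ 0<δ)) (half-pos (half-pos (proj₁ (proj₂ 0<δ))))
      in fromℚ 1/16 , (1/16 , ℚ.positive⁻¹ 1/16 , 0 , λ _ _ → ℚ.≤-reflexive (ℚ.+-identityˡ 1/16))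
       , N ℕ.⊔ 10 , λ n N⊔10≤n t {{t≢0}} L LL isLog isLogLog t≤cLL ‖avg‖ isNorm →
           let 10≤n = ⊔-≤ʳ {N} {10} N⊔10≤n
           in expectation-close-to-1 (suc (2 ^ n)) n t {{t≢0}}
                (lonely-rare t n {{t≢0}} (8t≤n t n 10≤n (16t≤8+n n L LL isLog isLogLog t t≤cLL)) 10≤n) ‖avg‖ isNorm δ 0<δ (small n (⊔-≤ˡ {N} {10} N⊔10≤n))
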